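{- Let $\mathfrak A=(A;\leq)$ be a linear ordering which admits a tree-automatic presentation. Then $\operatorname{FC}(\mathfrak A)<\omega^\omega$.
   Context: Trees and automata: Let $\Sigma$ be a finite alphabet. A tree domain is a finite prefix-closed subset $D\subseteq\{0,1\}^\star$; its boundary is $\partial D=\{ud: u\in D, d\in\{0,1\}, ud\notin D\}$ if $D\neq\emptyset$ and $\partial\emptyset=\{\varepsilon\}$. A $\Sigma$-tree is a map $t\colon D\to\Sigma$ with $D=\operatorname{dom}(t)$ a tree domain; $T_\Sigma$ denotes the set of all $\Sigma$-trees. A (deterministic bottom-up) tree automaton $\mathcal A=(Q,\iota,\delta,F)$ over $\Sigma$ has a finite state set $Q$, start state $\iota\in Q$, transition function $\delta\colon\Sigma\times Q\times Q\to Q$ and accepting set $F\subseteq Q$. For $t\in T_\Sigma$ and $u\in\operatorname{dom}(t)\cup\partial\operatorname{dom}(t)$ put $\mathcal A(t,u)=\delta(t(u),\mathcal A(t,u0),\mathcal A(t,u1))$ if $u\in\operatorname{dom}(t)$ and $\mathcal A(t,u)=\iota$ if $u\in\partial\operatorname{dom}(t)$. $\mathcal A$ recognises $L(\mathcal A)=\{t: \mathcal A(t,\varepsilon)\in F\}$; such languages are regular. For a new symbol $\Box\notin\Sigma$, the convolution of $(t_1,\dots,t_n)\in T_\Sigma^n$ is the $(\Sigma\cup\{\Box\})^n$-tree $\otimes\bar t$ with domain $\bigcup_i\operatorname{dom}(t_i)$ and label $(t_1'(u),\dots,t_n'(u))$ where $t_i'(u)=t_i(u)$ if $u\in\operatorname{dom}(t_i)$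 and $\Box$ otherwise. A relation $R\subseteq T_\Sigma^n$ is automatic if $\{\otimes\bar t:\bar t\in R\}$ is regular. A tree-automatic presentation of a structure $\mathfrak A=(A;(R^{\mathfrak A})_{R})$ over a finite relational signature is a tuple $(\mathcal A;(\mathcal A_R)_R)$ of tree automata together with a bijection $\mu\colon A\to L(\mathcal A)$ such that each $\mathcal A_R$ recognises $\{\otimes\bar t:\bar t\in\mu(R^{\mathfrak A})\}$. FC-rank: A condensation on a linear ordering $\mathfrak A$ is an equivalence relation whose classes are intervals; the classes are then linearly ordered, giving $\mathfrak A/\sim$. For ordinals $\alpha$ define $\sim_\alpha$: $\sim_0$ is the identity; $x\sim_{\beta+1}y$ iff the closed interval between the $\sim_\beta$-classes of $x$ and $y$ in $\mathfrak A/\sim_\beta$ is finite; for limit $\alpha$, $x\sim_\alpha y$ iff $x\sim_\beta y$ for some $\beta<\alpha$. $\operatorname{FC}(\mathfrak A)$ is the least ordinal $\alpha$ such that $\sim_\alpha$ and $\sim_\beta$ coincide for all $\beta\ge\alpha$. -}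

module Defs where

open import Data.Nat using (ℕ; zero; suc)
open import Data.Fin using (Fin)
open import Data.Bool using (Bool; T)
open import Data.Maybe using (Maybe; just; nothing)
open import Data.Product using (Σ; ∃; _×_; _,_; proj₁)
open import Data.Sum using (_⊎_)
open import Data.List using (List; foldl)
open import Data.List.Relation.Unary.Any using (Any)
open import Relation.Binary.PropositionalEquality using (_≡_)
open import Function.Bundles using (_⤖_; _⇔_; Bijection)

-- A Σ-tree: a finite binary tree whose nodes carry labels in S.
-- 'leaf' is a boundary position (outside the domain), 'node a l r' is a
-- domain position u with label a and subtrees at u0 and u1.
-- The empty tree (empty domain) is 'leaf'.
data Tree (S : Set) : Set where
  leaf : Tree S
  node : S → Tree S → Tree S → Tree S

record TreeAutomaton (S : Set) : Set where
  field
    states : ℕ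
    ι      : Fin states
    δ      : S → Fin states → Fin states → Fin states
    F      : Fin states → Bool

  run : Tree S → Fin states
  run leaf         = ι
  run (node a l r) = δ a (run l) (run r)

  Accepts : Tree S → Set
  Accepts t = T (F (run t))

-- Convolution of a pair of trees; nothing plays the role of □.
conv : {S : Set} → Tree S → Tree S → Tree (Maybe S × Maybe S)
conv leaf         leaf            = leaf
conv (node a l r) leaf            = node (just a , nothing) (conv l leaf) (conv r leaf)
conv leaf         (node b l r)    = node (nothing , just b) (conv leaf l) (conv leaf r)
conv (node a l r) (node b l′ r′)  = node (just a , just b) (conv l l′) (conv r r′)

record TreeAutomaticPresentation (A : Set) (_≤_ : A → A → Set) : Set₁ where
  field
    s      : ℕ
    domA   : TreeAutomaton (Fin s)
    leqA   : TreeAutomaton (Maybe (Fin s) × Maybe (Fin s))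
    μ      : A ⤖ Σ (Tree (Fin s)) (TreeAutomaton.Accepts domA)

  tree : A → Tree (Fin s)
  tree x = proj₁ (Bijection.to μ x)

  field
    leqSpec : ∀ (t : Tree (Maybe (Fin s) × Maybe (Fin s))) →
              TreeAutomaton.Accepts leqA t ⇔
              (∃ λ x → ∃ λ y → (x ≤ y) × (t ≡ conv (tree x) (tree y)))

module Condensation {A : Set} (_≤_ : A → A → Set) where

  Rel : Set₁
  Rel = A → A → Set

  Between : A → A → A → Set
  Between x y z = ((x ≤ z) × (z ≤ y)) ⊎ ((y ≤ z) × (z ≤ x))

  -- One condensation step: x C(R) y iff the closed interval between the
  -- R-classes of x and y in A/R is finite, i.e. it is covered by the
  -- R-classes of finitely many elements.
  step : Rel → Rel
  step R x y = ∃ λ (zs : List A) → ∀ z → Between x y z → Any (R z) zs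

  iterRel : (Rel → Rel) → ℕ → Rel → Rel
  iterRel f zero    R = R
  iterRel f (suc m) R = f (iterRel f m R)

  -- addω k R : passing from ~_β (= R) to ~_(β + ω^k).
  -- ~_(β+1) = step ~_β, and ~_(β + ω^(k+1)) = ⋃_m ~_(β + ω^k · m).
  addω : ℕ → Rel → Rel
  addω zero    R     = step R
  addω (suc k) R x y = ∃ λ m → iterRel (addω k) m R x y

  -- The ordinal ω^e₁ + ω^e₂ + … + ω^eₙ (< ω^ω) is coded by the list
  -- e₁ ∷ … ∷ eₙ; every ordinal < ω^ω arises this way.
  -- cond es = ~_α for α the ordinal coded by es.
  cond : List ℕ → Rel
  cond es = foldl (λ R e → addω e R) _≡_ es

{-# OPTIONS --safe #-}

-- Let τ u v be the state of the automaton for ≤ on the convolution of u and v, and η u the triple of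
-- τ u leaf, τ leaf u and τ u u. When a single subtree of a tree varies within a class η u ≡ p, the order
-- induced on that subtree is u ≤ v iff P (τ u v) for some set P of states. Such a pair (p , P) is called
-- a basic; there are finitely many of them.
--
-- For a set G of basics, let E x y say that all basics occurring between x and y, outside the domains of
-- x and y, are in G. This relation is recognizable. Starting from ∅, add to G every basic whose one-level
-- parts are in G, and every basic in each of whose intervals E has finitely many classes. The latter is
-- decidable: by pumping, finitely many classes are already represented by short trees. This stops, and
-- then E is closed under a condensation step: if E has finitely many classes between x and y, then also
-- in the intervals of each basic occurring there. Hence E contains every ∼_α.
--
-- Conversely, if E x y then the interval is a finite union of boxes, that is, of products of basics in G,
-- and the rank of a box is bounded by the natural sum of the ranks of its factors and a finite number.
-- So each round raises the bound on the rank from ω^k to ω^(k+1), and E is contained in ∼_(ω^k) for some k.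

module Submission where

open import Defs
open import Data.Nat as ℕ using (ℕ; zero; suc; _⊔_; _≤_; _<_; z≤n; s≤s; _+_)
open import Data.Nat.Properties as ℕₚ using ()
open import Data.Fin using (Fin; zero; suc; combine; remQuot; toℕ)
open import Data.Fin.Properties as Finₚ using (remQuot-combine; any?; all?; pigeonhole) renaming (_≟_ to _≟F_)
open import Data.Bool using (Bool; true; false; T; not; _∧_; _∨_; if_then_else_)
open import Data.Bool.Properties using (T?; T-≡; T-∧; T-irrelevant)
open import Data.Maybe using (Maybe; just; nothing)
open import Data.Product using (Σ; ∃; _×_; _,_; proj₁; proj₂; ∃₂)
open import Data.Sum as Sum using (_⊎_; inj₁; inj₂; swap)
open import Data.Empty using (⊥)
open import Data.Unit using (⊤; tt)
open import Data.Vec using (Vec; []; _∷_; map; lookup; tabulate; replicate; head; zipWith)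
open import Data.Vec.Properties using (lookup∘tabulate; tabulate-cong; lookup-map; lookup-replicate; []=⇒lookup; lookup⇒[]=)
open import Data.List as List using (List; []; _∷_; _++_; length)
open import Data.List.Relation.Unary.Any as Any using (Any; here; there; index)
open import Data.List.Relation.Unary.Any.Properties using (lookup-index; ++⁺ˡ; ++⁺ʳ; tabulate⁺; map⁺; concatMap⁺)
open import Data.List.Membership.Propositional using (_∈_; find; lose)
open import Data.List.Membership.Propositional.Properties using (∈-filter⁺; ∈-allFin; ∈-concatMap⁺; ∈-cartesianProductWith⁺; ∈-++⁺ˡ; ∈-++⁺ʳ; ∈-map⁺)
open import Data.List.Properties using (filter-notAll)
open import Relation.Nullary using (¬_; Dec; yes; no; does; contradiction; ¬?)
open import Relation.Nullary.Decidable using (map′; _×-dec_; _⊎-dec_; _→-dec_; does-⇔)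
open import Relation.Binary.PropositionalEquality using (_≡_; _≢_; refl; sym; trans; cong; cong₂; subst)
open import Relation.Binary.Definitions using (DecidableEquality; tri<; tri≈; tri>)
open import Function using (_∘_; id; case_of_)
open import Function.Bundles using (_⇔_; mk⇔; Equivalence; Bijection)
open import Data.Nat.Induction using (<-wellFounded)
open import Data.List.Membership.DecPropositional using () renaming (_∈?_ to mem?)
open import Induction.WellFounded using (Acc; acc; WellFounded)
open import Data.Fin.Subset using (Subset; ∣_∣; _⊂_)
open import Data.Fin.Subset.Properties using (∣p∣≤n; p⊂q⇒∣p∣<∣q∣)
open import Data.List.Relation.Unary.All as All using (All; []; _∷_)
open import Relation.Binary.Structures using (IsTotalOrder)

-- No ∼_α is shown to be recognizable itself. `E` is a recognizable relation squeezed between all of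
-- them and one fixed ∼_(ω^k); the exponent is two more than the number of rounds, and the finite
-- number of basics bounds the rounds.
--
-- The obstacle in bounding ranks is that a box is not ordered as a product: a loss in one
-- coordinate may be made up by a gain in the other. Finitely many states tame this. A loss is felt
-- only through its state, its colour, and the trees that escape the induction on the ranks of the
-- factors fall into sub-boxes in which some colour can no longer be made up. Hence the finite
-- summand in the rank of a box.
--
-- Boxes are rarely intervals. Ranks are therefore bounded first for covers by arbitrary
-- recognizable sets, and only `split` turns such covers into condensation steps.
--
-- The argument is constructive: emptiness, membership and the rules that enlarge G are all decided
-- by automata, so finiteness of a number of classes enters in a decidable form (`Canon`).

-- Finite types and exhaustive search

of-does : {A : Set} (a? : Dec A) → T (does a?) → A
of-does (yes a) _ = a

to-does : {A : Set} (a? : Dec A) → A → T (does a?)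
to-does (yes _) _ = tt
to-does (no ¬a) a = contradiction a ¬a

record Finite (C : Set) : Set where
  field
    size    : ℕ
    enc     : C → Fin size
    dec     : Fin size → C
    dec-enc : ∀ c → dec (enc c) ≡ c

  _≟_ : DecidableEquality C
  c ≟ d = map′ (λ e → trans (sym (dec-enc c)) (trans (cong dec e) (dec-enc d)))
               (cong enc) (enc c ≟F enc d)

  search : {P : C → Set} → (∀ c → Dec (P c)) → Dec (∃ P)
  search {P} P? = map′ (λ (i , p) → dec i , p) (λ (c , p) → enc c , subst P (sym (dec-enc c)) p)
                       (any? (P? ∘ dec))

  decAll : {P : C → Set} → (∀ c → Dec (P c)) → Dec (∀ c → P c)
  decAll {P} P? = map′ (λ f c → subst P (dec-enc c) (f (enc c))) (λ f → f ∘ dec) (all? (P? ∘ dec))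

  elems : List C
  elems = List.tabulate dec

open Finite using (enc; dec; dec-enc) public

finFin : ∀ {n} → Finite (Fin n)
finFin {n} = record { size = n ; enc = id ; dec = id ; dec-enc = λ _ → refl }

finBool : Finite Bool
finBool = record
  { size    = 2
  ; enc     = λ { false → zero ; true → suc zero }
  ; dec     = λ { zero → false ; (suc _) → true }
  ; dec-enc = λ { false → refl ; true → refl } }

fin× : ∀ {C D} → Finite C → Finite D → Finite (C × D)
fin× F G = record
  { enc     = λ (c , d) → combine (enc F c) (enc G d)
  ; dec     = λ i → let (a , b) = remQuot _ i in dec F a , dec G b
  ; dec-enc = λ (c , d) → trans
      (cong (λ (a , b) → dec F a , dec G b) (remQuot-combine (enc F c) (enc G d)))
      (cong₂ _,_ (dec-enc F c) (dec-enc G d)) }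

finVec : ∀ {C} → Finite C → ∀ n → Finite (Vec C n)
finVec F zero    = record { enc = λ _ → zero {0} ; dec = λ _ → [] ; dec-enc = λ { [] → refl } }
finVec F (suc n) = record
  { enc     = λ { (c ∷ cs) → enc G (c , cs) }
  ; dec     = λ i → let (c , cs) = dec G i in c ∷ cs
  ; dec-enc = λ { (c ∷ cs) → cong (λ (d , ds) → d ∷ ds) (dec-enc G (c , cs)) } }
  where G = fin× F (finVec F n)

-- Recognizable relations between trees

module Engine (s : ℕ) where

  Tr : Set
  Tr = Tree (Fin s)

  rt : Tr → Maybe (Fin s)
  rt leaf         = nothing
  rt (node a _ _) = just a

  isLeaf : Maybe (Fin s) → Bool
  isLeaf nothing  = true
  isLeaf (just _) = false

  lf rg : Tr → Tr
  lf leaf         = leaf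
  lf (node _ l _) = l
  rg leaf         = leaf
  rg (node _ _ r) = r

  ht : Tr → ℕ
  ht leaf         = 0
  ht (node _ l r) = suc (ht l ⊔ ht r)

  -- A finite-state function of k-tuples of trees, read bottom-up and in parallel;
  -- a tree that has already ended contributes the letter nothing and stays leaf.
  record Alg (k : ℕ) (C : Set) : Set where
    field
      φ   : Vec Tr k → C
      δ   : Vec (Maybe (Fin s)) k → C → C → C
      hom : ∀ ts → φ ts ≡ δ (map rt ts) (φ (map lf ts)) (φ (map rg ts))

  open Alg public

  encA : ∀ {k C} (F : Finite C) → Alg k C → Alg k (Fin (Finite.size F))
  encA F A = record
    { φ   = enc F ∘ φ A
    ; δ   = λ r c d → enc F (δ A r (dec F c) (dec F d))
    ; hom = λ ts → cong (enc F) (trans (hom A ts)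
              (sym (cong₂ (δ A (map rt ts)) (dec-enc F _) (dec-enc F _)))) }

  infixr 4 _⊗_
  _⊗_ : ∀ {k C D} → Alg k C → Alg k D → Alg k (C × D)
  A ⊗ B = record
    { φ   = λ ts → φ A ts , φ B ts
    ; δ   = λ r (c , d) (c′ , d′) → δ A r c c′ , δ B r d d′
    ; hom = λ ts → cong₂ _,_ (hom A ts) (hom B ts) }

  map-lookup : ∀ {k j} {X Y : Set} (f : X → Y) (xs : Vec X k) (is : Vec (Fin k) j) →
               map f (map (lookup xs) is) ≡ map (lookup (map f xs)) is
  map-lookup f xs []       = refl
  map-lookup f xs (i ∷ is) = cong₂ _∷_ (sym (lookup-map i f xs)) (map-lookup f xs is)

  reA : ∀ {k j C} → Vec (Fin k) j → Alg j C → Alg k C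
  reA is A = record
    { φ   = λ ts → φ A (map (lookup ts) is)
    ; δ   = λ r → δ A (map (lookup r) is)
    ; hom = λ ts → trans (hom A _)
              (trans (cong₂ (λ r c → δ A r c (φ A (map rg (map (lookup ts) is))))
                            (map-lookup rt ts is) (cong (φ A) (map-lookup lf ts is)))
                     (cong (δ A _ _) (cong (φ A) (map-lookup rg ts is)))) }

  Sec : Tr → Set → Set
  Sec leaf         C = C
  Sec (node _ l r) C = C × Sec l C × Sec r C

  top : ∀ t {C} → Sec t C → C
  top leaf         c       = c
  top (node _ _ _) (c , _) = c

  finSec : ∀ t {C} → Finite C → Finite (Sec t C)
  finSec leaf         F = F
  finSec (node _ l r) F = fin× F (fin× (finSec l F) (finSec r F))

  -- A bottom-up run does not know opposite which subtree of t it stands, so the state holds the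
  -- value of A against every subtree of t at once.
  secA : ∀ {k C} (t : Tr) → Alg (suc k) C → Alg k (Sec t C)
  secA-top : ∀ {k C} (t : Tr) (A : Alg (suc k) C) ts → top t (φ (secA t A) ts) ≡ φ A (t ∷ ts)
  secA leaf A = record
    { φ   = λ ts → φ A (leaf ∷ ts)
    ; δ   = λ r → δ A (nothing ∷ r)
    ; hom = λ ts → hom A (leaf ∷ ts) }
  secA t@(node a l r) A = record
    { φ   = λ ts → φ A (t ∷ ts) , φ (secA l A) ts , φ (secA r A) ts
    ; δ   = λ ρ (_ , cl , cr) (_ , dl , dr) →
              δ A (just a ∷ ρ) (top l cl) (top r dr) , δ (secA l A) ρ cl dl , δ (secA r A) ρ cr dr
    ; hom = λ ts → cong₂ _,_
              (trans (hom A (t ∷ ts))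
                     (sym (cong₂ (δ A _) (secA-top l A (map lf ts)) (secA-top r A (map rg ts)))))
              (cong₂ _,_ (hom (secA l A) ts) (hom (secA r A) ts)) }
  secA-top leaf         A ts = refl
  secA-top (node _ _ _) A ts = refl

  module Reach {m : ℕ} (A : Alg 1 (Fin m)) where

    ψ : Tr → Fin m
    ψ t = φ A (t ∷ [])

    Complete : List Tr → Set
    Complete ts = ∀ t → Any (λ u → ψ u ≡ ψ t) ts

    Closed : List Tr → Set
    Closed ts = Any (λ u → ψ u ≡ ψ leaf) ts ×
                (∀ a (i j : Fin (List.length ts)) →
                   Any (λ u → ψ u ≡ ψ (node a (List.lookup ts i) (List.lookup ts j))) ts)

    ψ-node : ∀ {a l l′ r r′} → ψ l ≡ ψ l′ → ψ r ≡ ψ r′ → ψ (node a l r) ≡ ψ (node a l′ r′)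
    ψ-node e f = trans (hom A _) (trans (cong₂ (δ A _) e f) (sym (hom A _)))

    closed⇒complete : ∀ ts → Closed ts → Complete ts
    closed⇒complete ts (c , _) leaf = c
    closed⇒complete ts cl@(_ , c) (node a l r) =
      let p = closed⇒complete ts cl l ; q = closed⇒complete ts cl r in
      Any.map (λ e → trans e (ψ-node (lookup-index p) (lookup-index q))) (c a (index p) (index q))

    find-new : ∀ ts → Closed ts ⊎ ∃ λ t → ¬ Any (λ u → ψ u ≡ ψ t) ts
    find-new ts with Any.any? (λ u → ψ u ≟F ψ leaf) ts
    ... | no ¬p = inj₂ (leaf , ¬p)
    ... | yes p with Finite.search (fin× finFin (fin× finFin finFin)) {P = λ (a , i , j) →
                       ¬ Any (λ u → ψ u ≡ ψ (node a (List.lookup ts i) (List.lookup ts j))) ts}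
                       (λ _ → ¬? (Any.any? (λ u → _ ≟F _) ts))
    ...   | yes (_ , ¬q) = inj₂ (_ , ¬q)
    ...   | no ¬q = inj₁ (p , λ a i j → case Any.any? (λ u → ψ u ≟F _) ts of λ where
                      (yes r) → r
                      (no ¬r) → contradiction ((a , i , j) , ¬r) ¬q)

    -- Invariant: a state not yet represented in `ts` is still in `missing`. Each new tree strikes
    -- its state off, so the length of `missing` bounds the rounds.
    saturate : ∀ fuel (missing : List (Fin m)) ts → List.length missing ≤ fuel →
               (∀ t → Any (λ u → ψ u ≡ ψ t) ts ⊎ ψ t ∈ missing) → ∃ Complete
    saturate fuel missing ts len inv with find-new ts
    ... | inj₁ cl = ts , closed⇒complete ts cl
    ... | inj₂ (t , new) with inv t
    ...   | inj₁ old = contradiction old new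
    saturate (suc fuel) missing ts len inv | inj₂ (t , new) | inj₂ t∈ =
      saturate fuel (List.filter (λ q → ¬? (q ≟F ψ t)) missing) (t ∷ ts)
        (ℕₚ.≤-pred (ℕₚ.≤-trans (filter-notAll _ missing (Any.map (λ e ne → ne (sym e)) t∈)) len)) λ u →
        case ψ t ≟F ψ u of λ where
          (yes e) → inj₁ (here e)
          (no ne) → Sum.map there (λ u∈ → ∈-filter⁺ _ u∈ (ne ∘ sym)) (inv u)
    saturate zero (_ ∷ _) ts () inv | inj₂ (t , new) | inj₂ (here _)
    saturate zero (_ ∷ _) ts () inv | inj₂ (t , new) | inj₂ (there _)

    complete : ∃ Complete
    complete = saturate _ (List.allFin m) [] ℕₚ.≤-refl (λ t → inj₂ (∈-allFin (ψ t)))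

    reach? : ∀ q → Dec (∃ λ t → ψ t ≡ q)
    reach? q = map′ (λ p → let (t , _ , e) = find p in t , e)
                    (λ (t , e) → Any.map (λ f → trans f e) (proj₂ complete t))
                    (Any.any? (λ t → ψ t ≟F q) (proj₁ complete))

  Bounded : ∀ {k} → ℕ → Vec Tr k → Set
  Bounded h []       = ⊤
  Bounded h (t ∷ ts) = ht t ≤ h × Bounded h ts

  bounded-all : ∀ {k} (ts : Vec Tr k) → ∃ λ h → Bounded h ts
  weaken : ∀ {k h h′} (ts : Vec Tr k) → h ≤ h′ → Bounded h ts → Bounded h′ ts
  bounded-all []       = 0 , tt
  bounded-all (t ∷ ts) = let (h , b) = bounded-all ts in
    ht t ⊔ h , ℕₚ.m≤m⊔n (ht t) h , weaken ts (ℕₚ.m≤n⊔m (ht t) h) b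
  weaken []       le b       = tt
  weaken (t ∷ ts) le (p , b) = ℕₚ.≤-trans p le , weaken ts le b

  bounded-lf : ∀ {k h} (ts : Vec Tr k) → Bounded (suc h) ts → Bounded h (map lf ts)
  bounded-lf []                _         = tt
  bounded-lf (leaf ∷ ts)       (_ , b)   = z≤n , bounded-lf ts b
  bounded-lf (node _ l r ∷ ts) (s≤s p , b) = ℕₚ.≤-trans (ℕₚ.m≤m⊔n _ _) p , bounded-lf ts b

  bounded-rg : ∀ {k h} (ts : Vec Tr k) → Bounded (suc h) ts → Bounded h (map rg ts)
  bounded-rg []                _         = tt
  bounded-rg (leaf ∷ ts)       (_ , b)   = z≤n , bounded-rg ts b
  bounded-rg (node _ l r ∷ ts) (s≤s p , b) = ℕₚ.≤-trans (ℕₚ.m≤n⊔m (ht l) _) p , bounded-rg ts b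

  bounded-0 : ∀ {k} (ts : Vec Tr k) → Bounded 0 ts → ts ≡ replicate k leaf
  bounded-0 []          _       = refl
  bounded-0 (leaf ∷ ts) (_ , b) = cong (leaf ∷_) (bounded-0 ts b)

  module Proj {k m : ℕ} (A : Alg (suc k) (Fin m)) where

    Fib : Vec Tr k → Fin m → Set
    Fib ts q = ∃ λ z → φ A (z ∷ ts) ≡ q

    Step : Vec (Maybe (Fin s)) k → Fin m → (Fin m → Set) → (Fin m → Set) → Fin m → Set
    Step ρ q₀ P Q q = q₀ ≡ q ⊎
      ∃ λ ((a , c , d) : Fin s × Fin m × Fin m) → P c × Q d × δ A (just a ∷ ρ) c d ≡ q

    Step? : ∀ ρ q₀ {P Q : Fin m → Set} → (∀ c → Dec (P c)) → (∀ d → Dec (Q d)) → ∀ q → Dec (Step ρ q₀ P Q q)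
    Step? ρ q₀ P? Q? q = (q₀ ≟F q) ⊎-dec
      Finite.search (fin× finFin (fin× finFin finFin)) (λ (a , c , d) → P? c ×-dec Q? d ×-dec (_ ≟F q))

    step⇒fib : ∀ ts q → Step (map rt ts) (φ A (leaf ∷ ts)) (Fib (map lf ts)) (Fib (map rg ts)) q → Fib ts q
    step⇒fib ts q (inj₁ e) = leaf , e
    step⇒fib ts q (inj₂ ((a , c , d) , (l , e) , (r , f) , g)) =
      node a l r , trans (hom A _) (trans (cong₂ (δ A _) e f) g)

    fib⇒step : ∀ ts q → Fib ts q → Step (map rt ts) (φ A (leaf ∷ ts)) (Fib (map lf ts)) (Fib (map rg ts)) q
    fib⇒step ts q (leaf , e)       = inj₁ e
    fib⇒step ts q (node a l r , e) = inj₂ ((a , _ , _) , (l , refl) , (r , refl) , trans (sym (hom A _)) e)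

    leaves : Alg 1 (Fin m)
    leaves = record
      { φ   = λ { (z ∷ []) → φ A (z ∷ replicate k leaf) }
      ; δ   = λ { (r ∷ []) → δ A (r ∷ replicate k nothing) }
      ; hom = λ { (z ∷ []) → trans (hom A _) (cong₂ (λ ρ f → f ρ) (cong (rt z ∷_) (rt-leaves k))
                (cong₂ (λ u v ρ → δ A ρ (φ A (lf z ∷ u)) (φ A (rg z ∷ v))) (lf-leaves k) (rg-leaves k))) } }
      where
      rt-leaves : ∀ j → map rt (replicate j leaf) ≡ replicate j nothing
      rt-leaves zero    = refl
      rt-leaves (suc j) = cong (nothing ∷_) (rt-leaves j)
      lf-leaves : ∀ j → map lf (replicate j leaf) ≡ replicate j leaf
      lf-leaves zero    = refl
      lf-leaves (suc j) = cong (leaf ∷_) (lf-leaves j)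
      rg-leaves : ∀ j → map rg (replicate j leaf) ≡ replicate j leaf
      rg-leaves zero    = refl
      rg-leaves (suc j) = cong (leaf ∷_) (rg-leaves j)

    -- The witness z may be deeper than every tree in ts. Recursion therefore follows the height of
    -- ts only; once all of ts has ended, what remains is reachability in the one-tape automaton
    -- `leaves`.
    fib?-bounded : ∀ h ts → Bounded h ts → ∀ q → Dec (Fib ts q)
    fib?-bounded zero ts b q with bounded-0 ts b
    ... | refl = Reach.reach? leaves q
    fib?-bounded (suc h) ts b q = map′ (step⇒fib ts q) (fib⇒step ts q)
      (Step? _ _ (fib?-bounded h _ (bounded-lf ts b)) (fib?-bounded h _ (bounded-rg ts b)) q)

    fib? : ∀ ts q → Dec (Fib ts q)
    fib? ts = let (h , b) = bounded-all ts in fib?-bounded h ts b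

    fibs : Vec Tr k → Vec Bool m
    fibs ts = tabulate (λ q → does (fib? ts q))

    in-fibs : ∀ ts q → Fib ts q → T (lookup (fibs ts) q)
    in-fibs ts q p = subst T (sym (lookup∘tabulate _ q)) (to-does (fib? ts q) p)

    out-fibs : ∀ ts q → T (lookup (fibs ts) q) → Fib ts q
    out-fibs ts q p = of-does (fib? ts q) (subst T (lookup∘tabulate _ q) p)

    -- Subset construction. The value at z = leaf is carried separately, because it depends on ts
    -- and is not determined by the sets for the two children.
    projA : Alg k (Fin m × Vec Bool m)
    projA = record
      { φ   = λ ts → φ A (leaf ∷ ts) , fibs ts
      ; δ   = λ ρ (q , P) (q′ , Q) → let q₀ = δ A (nothing ∷ ρ) q q′ in
                q₀ , tabulate (λ c → does (step? ρ q₀ P Q c))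
      ; hom = λ ts → cong₂ _,_ (hom A (leaf ∷ ts)) (tabulate-cong λ q →
                does-⇔ (mk⇔ (to ts q) (from ts q)) (fib? ts q) (step? _ _ (fibs (map lf ts)) (fibs (map rg ts)) q)) }
      where
      step? : ∀ ρ q₀ (P Q : Vec Bool m) q → Dec (Step ρ q₀ (T ∘ lookup P) (T ∘ lookup Q) q)
      step? ρ q₀ P Q = Step? ρ q₀ (λ c → T? (lookup P c)) (λ d → T? (lookup Q d))
      Step′ : Vec Tr k → Fin m → Set
      Step′ ts = Step (map rt ts) (δ A (nothing ∷ map rt ts) (φ A (leaf ∷ map lf ts)) (φ A (leaf ∷ map rg ts)))
                      (T ∘ lookup (fibs (map lf ts))) (T ∘ lookup (fibs (map rg ts)))
      to : ∀ ts q → Fib ts q → Step′ ts q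
      to ts q p with fib⇒step ts q p
      ... | inj₁ e = inj₁ (trans (sym (hom A _)) e)
      ... | inj₂ (x , c , d , e) = inj₂ (x , in-fibs _ _ c , in-fibs _ _ d , e)
      from : ∀ ts q → Step′ ts q → Fib ts q
      from ts q (inj₁ e) = leaf , trans (hom A _) e
      from ts q (inj₂ (x , c , d , e)) = step⇒fib ts q (inj₂ (x , out-fibs _ _ c , out-fibs _ _ d , e))

  record Rel (k : ℕ) : Set where
    field
      {size} : ℕ
      alg    : Alg k (Fin size)
      out    : Fin size → Bool

    holds : Vec Tr k → Bool
    holds ts = out (φ alg ts)

  open Rel public using (alg; out; holds)

  infix 4 _⊨_
  _⊨_ : ∀ {k} → Rel k → Vec Tr k → Set
  R ⊨ ts = T (holds R ts)

  record Reg {k : ℕ} (P : Vec Tr k → Set) : Set where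
    field
      rel      : Rel k
      sound    : ∀ ts → rel ⊨ ts → P ts
      complete : ∀ ts → P ts → rel ⊨ ts

    decide : ∀ ts → Dec (P ts)
    decide ts = map′ (sound ts) (complete ts) (T? (holds rel ts))

  open Reg public using (rel; sound; complete; decide)

  private
    asAlg : ∀ {k} {P : Vec Tr k → Set} (R : Reg P) → Alg k (Fin (Rel.size (rel R)))
    asAlg R = alg (rel R)

    via : ∀ {k} {P : Vec Tr k → Set} (R : Reg P) → Fin (Rel.size (rel R)) → Set
    via R q = T (out (rel R) q)

  abstract
    reg-alg : ∀ {k C} {P : C → Set} → Finite C → (A : Alg k C) → (∀ c → Dec (P c)) → Reg (λ ts → P (φ A ts))
    reg-alg {P = P} F A P? = record
      { rel      = record { alg = encA F A ; out = λ i → does (P? (dec F i)) }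
      ; sound    = λ ts h → subst P (dec-enc F _) (of-does (P? (dec F (enc F (φ A ts)))) h)
      ; complete = λ ts p → to-does (P? (dec F (enc F (φ A ts)))) (subst P (sym (dec-enc F _)) p) }

    reg-iff : ∀ {k} {P Q : Vec Tr k → Set} → (∀ ts → P ts → Q ts) → (∀ ts → Q ts → P ts) → Reg P → Reg Q
    reg-iff f g R = record
      { rel = rel R ; sound = λ ts h → f ts (sound R ts h) ; complete = λ ts q → complete R ts (g ts q) }

    reg-× : ∀ {k} {P Q : Vec Tr k → Set} → Reg P → Reg Q → Reg (λ ts → P ts × Q ts)
    reg-× R S = reg-iff (λ ts (p , q) → sound R ts p , sound S ts q)
                        (λ ts (p , q) → complete R ts p , complete S ts q)
      (reg-alg {P = λ (c , d) → via R c × via S d} (fin× finFin finFin) (asAlg R ⊗ asAlg S)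
               (λ _ → T? _ ×-dec T? _))

    reg-⊎ : ∀ {k} {P Q : Vec Tr k → Set} → Reg P → Reg Q → Reg (λ ts → P ts ⊎ Q ts)
    reg-⊎ R S = reg-iff (λ { ts (inj₁ p) → inj₁ (sound R ts p) ; ts (inj₂ q) → inj₂ (sound S ts q) })
                        (λ { ts (inj₁ p) → inj₁ (complete R ts p) ; ts (inj₂ q) → inj₂ (complete S ts q) })
      (reg-alg {P = λ (c , d) → via R c ⊎ via S d} (fin× finFin finFin) (asAlg R ⊗ asAlg S)
               (λ _ → T? _ ⊎-dec T? _))

    reg-→ : ∀ {k} {P Q : Vec Tr k → Set} → Reg P → Reg Q → Reg (λ ts → P ts → Q ts)
    reg-→ R S = reg-iff (λ ts f p → sound S ts (f (complete R ts p)))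
                        (λ ts f p → complete S ts (f (sound R ts p)))
      (reg-alg {P = λ (c , d) → via R c → via S d} (fin× finFin finFin) (asAlg R ⊗ asAlg S)
               (λ _ → T? _ →-dec T? _))

    reg-¬ : ∀ {k} {P : Vec Tr k → Set} → Reg P → Reg (λ ts → ¬ P ts)
    reg-¬ R = reg-iff (λ ts f p → f (complete R ts p)) (λ ts f p → f (sound R ts p))
      (reg-alg {P = ¬_ ∘ via R} finFin (asAlg R) (λ _ → ¬? (T? _)))

    reg-re : ∀ {k j} {P : Vec Tr j → Set} (is : Vec (Fin k) j) → Reg P → Reg (λ ts → P (map (lookup ts) is))
    reg-re is R = reg-iff (λ ts → sound R _) (λ ts → complete R _)
      (reg-alg {P = via R} finFin (reA is (asAlg R)) (λ _ → T? _))

    reg-sec : ∀ {k} {P : Vec Tr (suc k) → Set} (t : Tr) → Reg P → Reg (λ ts → P (t ∷ ts))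
    reg-sec t R = reg-iff (λ ts h → sound R _ (subst (via R) (secA-top t (asAlg R) ts) h))
                          (λ ts p → subst (via R) (sym (secA-top t (asAlg R) ts)) (complete R _ p))
      (reg-alg {P = λ c → via R (top t c)} (finSec t finFin) (secA t (asAlg R)) (λ _ → T? _))

    reg-∃ : ∀ {k} {P : Vec Tr (suc k) → Set} → Reg P → Reg (λ ts → ∃ λ z → P (z ∷ ts))
    reg-∃ {k} {P} R = reg-iff to from
      (reg-alg {P = λ (_ , Q) → ∃ λ q → via R q × T (lookup Q q)} (fin× finFin (finVec finBool _)) projA
               (λ _ → any? (λ _ → T? _ ×-dec T? _)))
      where
      open Proj (asAlg R)
      Coded : Vec Tr k → Set
      Coded ts = ∃ λ q → via R q × T (lookup (fibs ts) q)
      to : ∀ ts → Coded ts → ∃ λ z → P (z ∷ ts)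
      to ts (q , a , p) with out-fibs ts q p
      ... | z , e = z , sound R _ (subst (via R) (sym e) a)
      from : ∀ ts → (∃ λ z → P (z ∷ ts)) → Coded ts
      from ts (z , p) = _ , complete R _ p , in-fibs ts _ (z , refl)

    -- The passage through ¬∃¬ is constructive because membership in a recognizable relation is
    -- decidable.
    reg-∀ : ∀ {k} {P : Vec Tr (suc k) → Set} → Reg P → Reg (λ ts → ∀ z → P (z ∷ ts))
    reg-∀ R = reg-iff (λ ts h z → case decide R (z ∷ ts) of λ where
                         (yes p) → p
                         (no ¬p) → contradiction (z , ¬p) h)
                      (λ ts h (z , ¬p) → ¬p (h z))
                      (reg-¬ (reg-∃ (reg-¬ R)))

  RSet : Set
  RSet = Rel 1

  infix 4 _∈ᵣ_
  record _∈ᵣ_ (t : Tr) (X : RSet) : Set where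
    constructor mem
    field accepted : X ⊨ t ∷ []

  open _∈ᵣ_ public using (accepted)

  RegSet : (Tr → Set) → Set
  RegSet P = Reg {1} (P ∘ head)

  ∈⇒ : ∀ {P : Vec Tr 1 → Set} (R : Reg P) {t} → t ∈ᵣ rel R → P (t ∷ [])
  ∈⇒ R p = sound R _ (accepted p)

  ∈⇐ : ∀ {P : Vec Tr 1 → Set} (R : Reg P) {t} → P (t ∷ []) → t ∈ᵣ rel R
  ∈⇐ R p = mem (complete R _ p)

  reg-∈ : ∀ (X : RSet) → RegSet (_∈ᵣ X)
  reg-∈ X = record { rel = X ; sound = λ { (_ ∷ []) h → mem h } ; complete = λ { (_ ∷ []) h → accepted h } }

-- Basics and the relation E

module Types (s : ℕ) (M : TreeAutomaton (Maybe (Fin s) × Maybe (Fin s))) where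

  open Engine s
  open TreeAutomaton M using (states; ι; run) renaming (δ to δM; F to final)

  Q : Set
  Q = Fin states

  τ : Tr → Tr → Q
  τ u v = run (conv u v)

  δτ : Maybe (Fin s) → Maybe (Fin s) → Q → Q → Q
  δτ nothing  nothing  _ _ = ι
  δτ nothing  (just b)     = δM (nothing , just b)
  δτ (just a) m            = δM (just a , m)

  τA : Alg 2 Q
  τA = record
    { φ   = λ { (u ∷ v ∷ []) → τ u v }
    ; δ   = λ { (a ∷ b ∷ []) → δτ a b }
    ; hom = λ { (leaf ∷ leaf ∷ []) → refl ; (leaf ∷ node _ _ _ ∷ []) → refl
              ; (node _ _ _ ∷ leaf ∷ []) → refl ; (node _ _ _ ∷ node _ _ _ ∷ []) → refl } }

  -- The values of z against a tree that has ended, and against itself: below the domains of x and y,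
  -- nothing more about a subtree matters for the comparison with x and y (ty-plug).
  H : Set
  H = Q × Q × Q

  finH : Finite H
  finH = fin× finFin (fin× finFin finFin)

  η : Tr → H
  η z = τ z leaf , τ leaf z , τ z z

  dg : H → Q
  dg (_ , _ , d) = d

  ηA : Alg 1 H
  ηA = record
    { φ   = λ { (z ∷ []) → η z }
    ; δ   = λ { (a ∷ []) (p , q , d) (p′ , q′ , d′) → δτ a nothing p p′ , δτ nothing a q q′ , δτ a a d d′ }
    ; hom = λ { (leaf ∷ []) → refl ; (node _ _ _ ∷ []) → refl } }

  Θ : Set
  Θ = Q × Q × Q × Q × H

  finΘ : Finite Θ
  finΘ = fin× finFin (fin× finFin (fin× finFin (fin× finFin finH)))

  i0 : ∀ {n} → Fin (suc n)
  i0 = zero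
  i1 : ∀ {n} → Fin (suc (suc n))
  i1 = suc zero
  i2 : ∀ {n} → Fin (suc (suc (suc n)))
  i2 = suc i1
  i3 : ∀ {n} → Fin (suc (suc (suc (suc n))))
  i3 = suc i2

  on₂ : (Tr → Tr → Set) → Vec Tr 2 → Set
  on₂ R (x ∷ y ∷ []) = R x y

  on₃ : (Tr → Tr → Tr → Set) → Vec Tr 3 → Set
  on₃ R (x ∷ y ∷ z ∷ []) = R x y z

  tyA : Alg 3 Θ
  tyA = reA (i0 ∷ i2 ∷ []) τA ⊗ reA (i2 ∷ i0 ∷ []) τA ⊗ reA (i1 ∷ i2 ∷ []) τA
      ⊗ reA (i2 ∷ i1 ∷ []) τA ⊗ reA (i2 ∷ []) ηA

  ty : Tr → Tr → Tr → Θ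
  ty x y z = φ tyA (x ∷ y ∷ z ∷ [])

  Pr : Set
  Pr = Vec Bool states

  finPr : Finite Pr
  finPr = finVec finBool states

  infix 4 _≤[_]_
  record _≤[_]_ (u : Tr) (P : Pr) (v : Tr) : Set where
    constructor le
    field eval : T (lookup P (τ u v))

  open _≤[_]_ public using (eval)

  _≤[_]?_ : ∀ u P v → Dec (u ≤[ P ] v)
  u ≤[ P ]? v = map′ le eval (T? _)

  infix 4 _∈H_
  record _∈H_ (t : Tr) (D : H → Bool) : Set where
    constructor inH
    field type : T (D (η t))

  open _∈H_ public using (type)

  Btw : Pr → Tr → Tr → Tr → Set
  Btw P x y z = (x ≤[ P ] z × z ≤[ P ] y) ⊎ (y ≤[ P ] z × z ≤[ P ] x)

  -- The order that P induces on the trees l, via l ↦ node a l r for a fixed r with τ r r ≡ d; cR dually.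
  cL cR : Fin s → Q → Pr → Pr
  cL a d P = tabulate λ q → lookup P (δM (just a , just a) q d)
  cR a d P = tabulate λ q → lookup P (δM (just a , just a) d q)

  lookup-cL : ∀ a d P q → lookup (cL a d P) q ≡ lookup P (δM (just a , just a) q d)
  lookup-cL a d P q = lookup∘tabulate (λ q → lookup P (δM (just a , just a) q d)) q

  lookup-cR : ∀ a d P q → lookup (cR a d P) q ≡ lookup P (δM (just a , just a) d q)
  lookup-cR a d P q = lookup∘tabulate (λ q → lookup P (δM (just a , just a) d q)) q

  data Ctx : Set where
    hole : Ctx
    inl  : Fin s → Ctx → Tr → Ctx
    inr  : Fin s → Tr → Ctx → Ctx

  plug : Ctx → Tr → Tr
  plug hole        u = u
  plug (inl a K r) u = node a (plug K u) r
  plug (inr a l K) u = node a l (plug K u)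

  infixr 6 _∙_
  _∙_ : Ctx → Ctx → Ctx
  hole        ∙ L = L
  (inl a K r) ∙ L = inl a (K ∙ L) r
  (inr a l K) ∙ L = inr a l (K ∙ L)

  plug-∙ : ∀ K L u → plug (K ∙ L) u ≡ plug K (plug L u)
  plug-∙ hole        L u = refl
  plug-∙ (inl a K r) L u = cong (λ t → node a t r) (plug-∙ K L u)
  plug-∙ (inr a l K) L u = cong (node a l) (plug-∙ K L u)

  plug-injective : ∀ K {u v} → plug K u ≡ plug K v → u ≡ v
  plug-injective hole        e = e
  plug-injective (inl a K r) e = plug-injective K (cong lf e)
  plug-injective (inr a l K) e = plug-injective K (cong rg e)

  ∙-assoc : ∀ K L J → (K ∙ L) ∙ J ≡ K ∙ (L ∙ J)
  ∙-assoc hole        L J = refl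
  ∙-assoc (inl a K r) L J = cong (λ t → inl a t r) (∙-assoc K L J)
  ∙-assoc (inr a l K) L J = cong (inr a l) (∙-assoc K L J)

  cm : Ctx → Pr → Pr
  cm hole        P = P
  cm (inl a K r) P = cm K (cL a (dg (η r)) P)
  cm (inr a l K) P = cm K (cR a (dg (η l)) P)

  cm-∙ : ∀ K L P → cm (K ∙ L) P ≡ cm L (cm K P)
  cm-∙ hole        L P = refl
  cm-∙ (inl a K r) L P = cm-∙ K L _
  cm-∙ (inr a l K) L P = cm-∙ K L _

  cm-≤ : ∀ K P u v → lookup (cm K P) (τ u v) ≡ lookup P (τ (plug K u) (plug K v))
  cm-≤ hole        P u v = refl
  cm-≤ (inl a K r) P u v = trans (cm-≤ K _ u v) (lookup-cL a _ P _)
  cm-≤ (inr a l K) P u v = trans (cm-≤ K _ u v) (lookup-cR a _ P _)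

  module _ (K : Ctx) (P : Pr) {u v : Tr} where
    ≤-plug : u ≤[ cm K P ] v → plug K u ≤[ P ] plug K v
    ≤-plug p = le (subst T (cm-≤ K P u v) (eval p))

    ≤-unplug : plug K u ≤[ P ] plug K v → u ≤[ cm K P ] v
    ≤-unplug p = le (subst T (sym (cm-≤ K P u v)) (eval p))

  -- Out K x: the hole of K lies outside the domain of x.
  Out : Ctx → Tr → Set
  Out hole        x = x ≡ leaf
  Out (inl a K r) x = Out K (lf x)
  Out (inr a l K) x = Out K (rg x)

  out-leaf : ∀ K → Out K leaf
  out-leaf hole        = refl
  out-leaf (inl a K r) = out-leaf K
  out-leaf (inr a l K) = out-leaf K

  out-∙ : ∀ K L x → Out K x → Out (K ∙ L) x
  out-∙ hole        L x o = subst (Out L) (sym o) (out-leaf L)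
  out-∙ (inl a K r) L x o = out-∙ K L (lf x) o
  out-∙ (inr a l K) L x o = out-∙ K L (rg x) o

  out-plug : ∀ K L x → Out L x → Out (K ∙ L) (plug K x)
  out-plug hole        L x o = o
  out-plug (inl a K r) L x o = out-plug K L x o
  out-plug (inr a l K) L x o = out-plug K L x o

  sub : Ctx → Tr → Tr
  sub hole        x = x
  sub (inl a K r) x = sub K (lf x)
  sub (inr a l K) x = sub K (rg x)

  out-sub : ∀ K L x → Out L (sub K x) → Out (K ∙ L) x
  out-sub hole        L x o = o
  out-sub (inl a K r) L x o = out-sub K L (lf x) o
  out-sub (inr a l K) L x o = out-sub K L (rg x) o

  node-ty : ∀ x y a {l l′ r r′} → ty (lf x) (lf y) l ≡ ty (lf x) (lf y) l′ → ty (rg x) (rg y) r ≡ ty (rg x) (rg y) r′ →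
            ty x y (node a l r) ≡ ty x y (node a l′ r′)
  node-ty x y a e f = trans (hom tyA (x ∷ y ∷ node a _ _ ∷ []))
    (trans (cong₂ (Alg.δ tyA (rt x ∷ rt y ∷ just a ∷ [])) e f) (sym (hom tyA (x ∷ y ∷ node a _ _ ∷ []))))

  ty-plug : ∀ K x y u v → Out K x → Out K y → η u ≡ η v → ty x y (plug K u) ≡ ty x y (plug K v)
  ty-plug hole _ _ u v refl refl e =
    let p = cong proj₁ e ; q = cong (proj₁ ∘ proj₂) e in
    cong₂ _,_ q (cong₂ _,_ p (cong₂ _,_ q (cong₂ _,_ p e)))
  ty-plug (inl a K r) x y u v ox oy e = node-ty x y a (ty-plug K (lf x) (lf y) u v ox oy e) refl
  ty-plug (inr a l K) x y u v ox oy e = node-ty x y a refl (ty-plug K (rg x) (rg y) u v ox oy e)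

  tyη : Θ → H
  tyη (_ , _ , _ , _ , h) = h

  btwΘ : Pr → Θ → Set
  btwΘ P (xz , zx , yz , zy , _) = (T (lookup P xz) × T (lookup P zy)) ⊎ (T (lookup P yz) × T (lookup P zx))

  btwΘ? : ∀ P θ → Dec (btwΘ P θ)
  btwΘ? P θ = (T? _ ×-dec T? _) ⊎-dec (T? _ ×-dec T? _)

  btw⇒Θ : ∀ P x y z → Btw P x y z → btwΘ P (ty x y z)
  btw⇒Θ P x y z = Sum.map (λ (p , q) → eval p , eval q) (λ (p , q) → eval p , eval q)

  Θ⇒btw : ∀ P x y z → btwΘ P (ty x y z) → Btw P x y z
  Θ⇒btw P x y z = Sum.map (λ (p , q) → le p , le q) (λ (p , q) → le p , le q)

  η-plug : ∀ K u v → η u ≡ η v → η (plug K u) ≡ η (plug K v)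
  η-plug K u v e = cong tyη (ty-plug K leaf leaf u v (out-leaf K) (out-leaf K) e)

  record Lin (Z : Tr → Set) (P : Pr) : Set where
    field
      ≤-refl    : ∀ {x} → Z x → x ≤[ P ] x
      ≤-antisym : ∀ {x y} → Z x → Z y → x ≤[ P ] y → y ≤[ P ] x → x ≡ y
      ≤-trans   : ∀ {x y z} → Z x → Z y → Z z → x ≤[ P ] y → y ≤[ P ] z → x ≤[ P ] z
      ≤-total   : ∀ {x y} → Z x → Z y → x ≤[ P ] y ⊎ y ≤[ P ] x

  lin-⊆ : ∀ {Z Z′ P} → (∀ {t} → Z′ t → Z t) → Lin Z P → Lin Z′ P
  lin-⊆ f L = record
    { ≤-refl = ≤-refl ∘ f ; ≤-antisym = λ x y → ≤-antisym (f x) (f y)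
    ; ≤-trans = λ x y z → ≤-trans (f x) (f y) (f z) ; ≤-total = λ x y → ≤-total (f x) (f y) }
    where open Lin L

  lin-plug : ∀ {Z Z′ P} K → (∀ {t} → Z′ t → Z (plug K t)) → Lin Z P → Lin Z′ (cm K P)
  lin-plug {P = P} K f L = record
    { ≤-refl    = λ x → ≤-unplug K P (≤-refl (f x))
    ; ≤-antisym = λ x y p q → plug-injective K (≤-antisym (f x) (f y) (≤-plug K P p) (≤-plug K P q))
    ; ≤-trans   = λ x y z p q → ≤-unplug K P (≤-trans (f x) (f y) (f z) (≤-plug K P p) (≤-plug K P q))
    ; ≤-total   = λ x y → Sum.map (≤-unplug K P) (≤-unplug K P) (≤-total (f x) (f y)) }
    where open Lin L

  abstract
    finB : Finite (H × Pr)
    finB = fin× finH finPr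

  module Good (G : H → Pr → Bool) where

    here? : Pr → Maybe (Fin s) → Maybe (Fin s) → H → Bool
    here? P a b p = not (isLeaf a ∧ isLeaf b) ∨ G p P

    gd : Pr → Tr → Tr → Tr → Bool
    gd P x y leaf           = here? P (rt x) (rt y) (η leaf)
    gd P x y z@(node a l r) = here? P (rt x) (rt y) (η z)
      ∧ gd (cL a (dg (η r)) P) (lf x) (lf y) l ∧ gd (cR a (dg (η l)) P) (rg x) (rg y) r

    N : ℕ
    N = Finite.size finPr

    -- P changes on the way down while the automaton runs upwards, so a state tabulates the answer
    -- for every P.
    gdA : Alg 3 (H × Vec Bool N)
    gdA = record
      { φ   = λ { (x ∷ y ∷ z ∷ []) → η z , table (λ P → gd P x y z) }
      ; δ   = λ { (a ∷ b ∷ nothing ∷ []) _ _ → η leaf , table (λ P → here? P a b (η leaf))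
                ; (a ∷ b ∷ just c ∷ []) (h , tl) (h′ , tr) →
                    let h″ = Alg.δ ηA (just c ∷ []) h h′ in
                    h″ , table (λ P → here? P a b h″ ∧ at tl (cL c (dg h′) P) ∧ at tr (cR c (dg h) P)) }
      ; hom = λ { (x ∷ y ∷ leaf ∷ []) → refl
                ; (x ∷ y ∷ node c l r ∷ []) → cong (η (node c l r) ,_) (tabulate-cong λ i →
                    cong (here? (dec finPr i) (rt x) (rt y) (η (node c l r)) ∧_)
                      (sym (cong₂ _∧_ (at-table (λ P → gd P (lf x) (lf y) l) (cL c (dg (η r)) (dec finPr i)))
                                      (at-table (λ P → gd P (rg x) (rg y) r) (cR c (dg (η l)) (dec finPr i)))))) } }
      where
      table : (Pr → Bool) → Vec Bool N
      table f = tabulate (f ∘ dec finPr)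
      at : Vec Bool N → Pr → Bool
      at t P = lookup t (enc finPr P)
      at-table : ∀ f P → at (table f) P ≡ f P
      at-table f P = trans (lookup∘tabulate _ (enc finPr P)) (cong f (dec-enc finPr P))

    reg-gd : ∀ P → Reg (on₃ λ x y z → T (gd P x y z))
    reg-gd P = reg-iff (λ { (x ∷ y ∷ z ∷ []) → subst T (eq x y z) }) (λ { (x ∷ y ∷ z ∷ []) → subst T (sym (eq x y z)) })
      (reg-alg {P = λ (_ , t) → T (lookup t (enc finPr P))} (fin× finH (finVec finBool N)) gdA (λ _ → T? _))
      where
      eq : ∀ x y z → lookup (proj₂ (φ gdA (x ∷ y ∷ z ∷ []))) (enc finPr P) ≡ gd P x y z
      eq x y z = trans (lookup∘tabulate _ (enc finPr P)) (cong (λ P → gd P x y z) (dec-enc finPr P))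

    Basic : H → Pr → Set
    Basic p P = T (G p P)

    private
      T-∧₁ : ∀ {b c} → T (b ∧ c) → T b
      T-∧₁ {true} _ = tt
      T-∧₂ : ∀ {b c} → T (b ∧ c) → T c
      T-∧₂ {true} h = h
      T-pair : ∀ {b c} → T b → T c → T (b ∧ c)
      T-pair {true} _ h = h

    gd⇒ : ∀ {P x y z} → T (gd P x y z) → ∀ K {u} → z ≡ plug K u → Out K x → Out K y → Basic (η u) (cm K P)
    gd⇒ {z = leaf}       h hole        refl refl refl = h
    gd⇒ {z = node _ _ _} h hole        refl refl refl = T-∧₁ h
    gd⇒ {P} {x} {y} {z = node _ _ r} h (inl a K r) refl ox oy =
      gd⇒ (T-∧₁ (T-∧₂ {here? P (rt x) (rt y) _} h)) K refl ox oy
    gd⇒ {P} {x} {y} {z = node _ l _} h (inr a l K) refl ox oy =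
      gd⇒ (T-∧₂ {gd (cL a _ P) _ _ l} (T-∧₂ {here? P (rt x) (rt y) _} h)) K refl ox oy

    gd⇐ : ∀ {P x y} z → (∀ K u → z ≡ plug K u → Out K x → Out K y → Basic (η u) (cm K P)) → T (gd P x y z)
    gd⇐-here : ∀ {P} x y z → (∀ K u → z ≡ plug K u → Out K x → Out K y → Basic (η u) (cm K P)) →
               T (here? P (rt x) (rt y) (η z))
    gd⇐-here leaf leaf z f = f hole z refl refl refl
    gd⇐-here leaf (node _ _ _) z f = tt
    gd⇐-here (node _ _ _) _ z f = tt
    gd⇐ {P} {x} {y} leaf f = gd⇐-here x y leaf f
    gd⇐ {P} {x} {y} (node a l r) f = T-pair (gd⇐-here x y (node a l r) f) (T-pair
      (gd⇐ l (λ K u e → f (inl a K r) u (cong (λ t → node a t r) e)))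
      (gd⇐ r (λ K u e → f (inr a l K) u (cong (node a l) e))))

    -- E D P x y: every basic that occurs between x and y, outside their domains, is in G.
    E : (H → Bool) → Pr → Tr → Tr → Set
    E D P x y = ∀ z → z ∈H D → Btw P x y z → T (gd P x y z)

    E-regular : ∀ D P → Reg (on₂ (E D P))
    E-regular D P = reg-iff (λ { (x ∷ y ∷ []) f z d b → f z (type d , btw⇒Θ P x y z b) }) (λ { (x ∷ y ∷ []) f z (d , b) → f z (inH d) (Θ⇒btw P x y z b) })
      (reg-∀ (reg-→ (reg-re (i1 ∷ i2 ∷ i0 ∷ []) R) (reg-re (i1 ∷ i2 ∷ i0 ∷ []) (reg-gd P))))
      where
      R : Reg {3} (λ ts → T (D (tyη (φ tyA ts))) × btwΘ P (φ tyA ts))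
      R = reg-alg {P = λ θ → T (D (tyη θ)) × btwΘ P θ} finΘ tyA (λ θ → T? _ ×-dec btwΘ? P θ)

    E-basic : ∀ {D P x y} → E D P x y → ∀ K u → Out K x → Out K y → plug K u ∈H D →
              Btw P x y (plug K u) → Basic (η u) (cm K P)
    E-basic e K u ox oy d b = gd⇒ (e _ d b) K refl ox oy

    E-intro : ∀ {D P x y} → (∀ K u → Out K x → Out K y → plug K u ∈H D →
              Btw P x y (plug K u) → Basic (η u) (cm K P)) → E D P x y
    E-intro {D} {P} {x} {y} f z d b = gd⇐ z λ K u e ox oy →
      f K u ox oy (subst (_∈H D) e d) (subst (Btw P x y) e b)

    E-sym : ∀ {D P x y} → E D P x y → E D P y x
    E-sym e = E-intro λ K u ox oy d b → E-basic e K u oy ox d (swap b)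

    E-unplug : ∀ {D D′ P} K → (∀ {t} → t ∈H D′ → plug K t ∈H D) →
               ∀ {x y} → E D P (plug K x) (plug K y) → E D′ (cm K P) x y
    E-unplug {D} {D′} {P} K f {x} {y} e = E-intro λ L u ox oy d b →
      subst (Basic (η u)) (cm-∙ K L P)
        (E-basic e (K ∙ L) u (out-plug K L x ox) (out-plug K L y oy)
          (subst (_∈H D) (sym (plug-∙ K L u)) (f d))
          (subst (Btw P _ _) (sym (plug-∙ K L u))
            (Sum.map (λ (p , q) → ≤-plug K P p , ≤-plug K P q) (λ (p , q) → ≤-plug K P p , ≤-plug K P q) b)))

    Saturated : Set
    Saturated = ∀ p P → (∀ a l r → η (node a l r) ≡ p →
                  Basic (η l) (cL a (dg (η r)) P) × Basic (η r) (cR a (dg (η l)) P)) → Basic p P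

    module Sat (sat : Saturated) where

      -- When y has ended, f cannot simply be used at `hole`: that needs a tree of type p, and there
      -- may be none. Saturation asks only about the nodes of type p, and also admits types without
      -- nodes.
      deep : ∀ y p P → (∀ L u → η (plug L u) ≡ p → Out L y → Basic (η u) (cm L P)) → Basic p P
      deep leaf p P f = sat p P λ a l r e → f (inl a hole r) l e refl , f (inr a l hole) r e refl
      deep (node b y₀ y₁) p P f = sat p P λ a l r e →
        deep y₀ (η l) _ (λ L u e′ o → f (inl a L r) u (trans (η-plug (inl a hole r) (plug L u) l e′) e) o) ,
        deep y₁ (η r) _ (λ L u e′ o → f (inr a l L) u (trans (η-plug (inr a l hole) (plug L u) r e′) e) o)

      module _ {D : H → Bool} {P : Pr} where

        Btw-plug : ∀ K {x y u v} → Out K x → Out K y → η u ≡ η v → Btw P x y (plug K u) → Btw P x y (plug K v)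
        Btw-plug K {x} {y} {u} {v} ox oy e b = Θ⇒btw P x y (plug K v)
          (subst (btwΘ P) (ty-plug K x y u v ox oy e) (btw⇒Θ P x y (plug K u) b))

        ∈H-plug : ∀ K {u v} → η u ≡ η v → plug K u ∈H D → plug K v ∈H D
        ∈H-plug K {u} {v} e (inH d) = inH (subst (T ∘ D) (η-plug K u v e) d)

        -- When G is saturated, the positions in the domain of w need not be inspected.
        E-deep : ∀ {x y} w → (∀ K u → Out K x → Out K y → Out K w → plug K u ∈H D →
                 Btw P x y (plug K u) → Basic (η u) (cm K P)) → E D P x y
        E-deep {x} {y} w f = E-intro λ K u ox oy d b → deep (sub K w) (η u) (cm K P) λ L v e o →
          subst (Basic (η v)) (cm-∙ K L P) (f (K ∙ L) v (out-∙ K L x ox) (out-∙ K L y oy) (out-sub K L w o)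
            (subst (_∈H D) (sym (plug-∙ K L v)) (∈H-plug K {u} {plug L v} (sym e) d))
            (subst (Btw P x y) (sym (plug-∙ K L v)) (Btw-plug K {x} {y} {u} {plug L v} ox oy (sym e) b)))

        module _ (lin : Lin (_∈H D) P) where
          open Lin lin

          -- By antisymmetry only x lies between x and x. A node placed outside the domain of x
          -- would give another such tree, so the types that occur there contain no node and their
          -- basics are in G vacuously.
          E-refl : ∀ {x} → x ∈H D → E D P x x
          E-refl {x} dx = E-intro λ K u ox _ d b → sat (η u) (cm K P) λ a l r e →
            let v = node a l r
                d′ = ∈H-plug K {u} {v} (sym e) d
                b′ = Btw-plug K {x} {x} {u} {v} ox ox (sym e) b
                ev = collapse d′ b′
                out = subst (Out K) (sym ev) ox
            in contradiction out (not-out K a l r)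
            where
            collapse : ∀ {z} → z ∈H D → Btw P x x z → z ≡ x
            collapse dz (inj₁ (p , q)) = ≤-antisym dz dx q p
            collapse dz (inj₂ (p , q)) = ≤-antisym dz dx q p
            not-out : ∀ K a l r → ¬ Out K (plug K (node a l r))
            not-out hole        a l r ()
            not-out (inl _ K _) a l r o = not-out K a l r o
            not-out (inr _ _ K) a l r o = not-out K a l r o

          Btw-split : ∀ {x y w z} → x ∈H D → y ∈H D → w ∈H D → z ∈H D →
                      Btw P x y z → Btw P x w z ⊎ Btw P w y z
          Btw-split dx dy dw dz (inj₁ (p , q)) with ≤-total dz dw
          ... | inj₁ r = inj₁ (inj₁ (p , r))
          ... | inj₂ r = inj₂ (inj₁ (r , q))
          Btw-split dx dy dw dz (inj₂ (p , q)) with ≤-total dz dw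
          ... | inj₁ r = inj₂ (inj₂ (p , r))
          ... | inj₂ r = inj₁ (inj₂ (r , q))

          Btw-sub : ∀ {x y w z} → x ∈H D → y ∈H D → w ∈H D → z ∈H D →
                    Btw P x y w → Btw P x w z → Btw P x y z
          Btw-sub dx dy dw dz (inj₁ (p , q)) (inj₁ (r , t)) = inj₁ (r , ≤-trans dz dw dy t q)
          Btw-sub dx dy dw dz (inj₁ (p , q)) (inj₂ (r , t)) = inj₁ (≤-trans dx dw dz p r , ≤-trans dz dx dy t (≤-trans dx dw dy p q))
          Btw-sub dx dy dw dz (inj₂ (p , q)) (inj₁ (r , t)) = inj₂ (≤-trans dy dx dz (≤-trans dy dw dx p q) r , ≤-trans dz dw dx t q)
          Btw-sub dx dy dw dz (inj₂ (p , q)) (inj₂ (r , t)) = inj₂ (≤-trans dy dw dz p r , t)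

          -- A position outside the domains of x and y may lie inside that of w, where neither
          -- premise speaks. `E-deep` moves below w, and there one of the two premises applies.
          E-trans : ∀ {x w y} → x ∈H D → w ∈H D → y ∈H D → E D P x w → E D P w y → E D P x y
          E-trans {x} {w} {y} dx dw dy e f = E-deep w λ K u ox oy ow d b → case Btw-split dx dy dw d b of λ where
            (inj₁ c) → E-basic e K u ox ow d c
            (inj₂ c) → E-basic f K u ow oy d c

          E-convex : ∀ {x w y} → x ∈H D → w ∈H D → y ∈H D → E D P x y → Btw P x y w → E D P x w
          E-convex {x} {w} {y} dx dw dy e b = E-deep y λ K u ox ow oy d c → E-basic e K u ox oy d (Btw-sub dx dy dw d b c)

-- Cantor normal forms below ω^k, most significant coefficient first.
infix 4 _≺_
data _≺_ : ∀ {k} → Vec ℕ k → Vec ℕ k → Set where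
  hd : ∀ {k m n} {a b : Vec ℕ k} → m < n → m ∷ a ≺ n ∷ b
  tl : ∀ {k m} {a b : Vec ℕ k} → a ≺ b → m ∷ a ≺ m ∷ b

≺-trans : ∀ {k} {a b c : Vec ℕ k} → a ≺ b → b ≺ c → a ≺ c
≺-trans (hd p) (hd q) = hd (ℕₚ.<-trans p q)
≺-trans (hd p) (tl q) = hd p
≺-trans (tl p) (hd q) = hd q
≺-trans (tl p) (tl q) = tl (≺-trans p q)

≺-wf : ∀ {k} → WellFounded (_≺_ {k})
∷-acc : ∀ {k n} → Acc _<_ n → {a : Vec ℕ k} → Acc _≺_ a → Acc _≺_ (n ∷ a)
∷-acc′ : ∀ {k n} → Acc _<_ n → {a : Vec ℕ k} → Acc _≺_ a → ∀ {b} → b ≺ n ∷ a → Acc _≺_ b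
≺-wf []      = acc λ ()
≺-wf (n ∷ a) = ∷-acc (<-wellFounded n) (≺-wf a)
∷-acc p q = acc (∷-acc′ p q)
∷-acc′ (acc p) q (hd lt) = ∷-acc (p lt) (≺-wf _)
∷-acc′ p (acc q) (tl lt) = ∷-acc p (q lt)

infixl 6 _⊕_
_⊕_ : ∀ {k} → Vec ℕ k → Vec ℕ k → Vec ℕ k
_⊕_ = zipWith _+_

⊕-comm : ∀ {k} (a b : Vec ℕ k) → a ⊕ b ≡ b ⊕ a
⊕-comm []      []      = refl
⊕-comm (m ∷ a) (n ∷ b) = cong₂ _∷_ (ℕₚ.+-comm m n) (⊕-comm a b)

⊕-monoˡ : ∀ {k} {a b : Vec ℕ k} c → a ≺ b → a ⊕ c ≺ b ⊕ c
⊕-monoˡ (n ∷ c) (hd p) = hd (ℕₚ.+-monoˡ-< n p)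
⊕-monoˡ (n ∷ c) (tl p) = tl (⊕-monoˡ c p)

⊕-monoʳ : ∀ {k} {a b : Vec ℕ k} c → a ≺ b → c ⊕ a ≺ c ⊕ b
⊕-monoʳ (n ∷ c) (hd p) = hd (ℕₚ.+-monoʳ-< n p)
⊕-monoʳ (n ∷ c) (tl p) = tl (⊕-monoʳ c p)

fin : ∀ k → ℕ → Vec ℕ (suc k)
fin zero    n = n ∷ []
fin (suc k) n = 0 ∷ fin k n

fin-mono : ∀ k {m n} → m < n → fin k m ≺ fin k n
fin-mono zero    p = hd p
fin-mono (suc k) p = tl (fin-mono k p)

zeros : ∀ k → Vec ℕ k
zeros k = replicate k 0

-- Single trees serve as pieces of rank `zeros`; the successor in `boxRank` keeps room for them
-- below every box, even when no colour is left.
zeros≺⊕fin : ∀ {k} (a : Vec ℕ (suc k)) n → zeros (suc k) ≺ a ⊕ fin k (suc n)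
zeros≺⊕fin {zero}  (zero ∷ [])  n = hd (s≤s z≤n)
zeros≺⊕fin {zero}  (suc m ∷ []) n = hd (s≤s z≤n)
zeros≺⊕fin {suc k} (zero ∷ a)   n = tl (zeros≺⊕fin a n)
zeros≺⊕fin {suc k} (suc m ∷ a)  n = hd (s≤s z≤n)

-- Decreases in every step of the box lemma: the natural sum of the ranks of the two factors,
-- plus the number of colours still available to either.
boxRank : ∀ {k} → Vec ℕ (suc k) → Vec ℕ (suc k) → ℕ → ℕ → Vec ℕ (suc k)
boxRank {k} α β m n = (α ⊕ β) ⊕ fin k (suc (m + n))

boxRank-comm : ∀ {k} (α β : Vec ℕ (suc k)) m n → boxRank β α n m ≡ boxRank α β m n
boxRank-comm {k} α β m n = cong₂ (λ a i → a ⊕ fin k (suc i)) (⊕-comm β α) (ℕₚ.+-comm n m)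

-- Thin sets and the box lemma

module Covers (s : ℕ) (M : TreeAutomaton (Maybe (Fin s) × Maybe (Fin s))) where

  open Engine s
  open Types s M

  -- An inductive bound on the rank of X under P. Pieces need not be intervals, disjoint, or
  -- contained in X: this is what lets boxes serve as pieces.
  data Thin {k : ℕ} (P : Pr) (c : Vec ℕ k) (X : RSet) : Set

  record Piece {k : ℕ} (P : Pr) (c : Vec ℕ k) : Set where
    inductive
    constructor piece
    field
      {rank} : Vec ℕ k
      below  : rank ≺ c
      set    : RSet
      thin   : Thin P rank set

  data Thin P c X where
    point   : (∀ {t t′} → t ∈ᵣ X → t′ ∈ᵣ X → t ≡ t′) → Thin P c X
    covered : (∀ {t t′} → t ∈ᵣ X → t′ ∈ᵣ X →
                 Σ (List (Piece P c)) λ ps →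
                   ∀ z → z ∈ᵣ X → t ≤[ P ] z → z ≤[ P ] t′ → Any (λ p → z ∈ᵣ Piece.set p) ps) →
              Thin P c X

  open Piece public

  Cover : ∀ {k} → Pr → Vec ℕ k → (Tr → Set) → Set
  Cover P c Z = Σ (List (Piece P c)) λ ps → ∀ z → Z z → Any (λ p → z ∈ᵣ set p) ps

  module _ {k} {P : Pr} {c : Vec ℕ k} where

    cover-⊆ : ∀ {Z Z′ : Tr → Set} → (∀ z → Z′ z → Z z) → Cover P c Z → Cover P c Z′
    cover-⊆ f (ps , h) = ps , λ z → h z ∘ f z

    cover-∅ : ∀ {Z : Tr → Set} → (∀ z → ¬ Z z) → Cover P c Z
    cover-∅ f = [] , λ z p → contradiction p (f z)

    cover-⊎ : ∀ {Z Z′ : Tr → Set} → Cover P c Z → Cover P c Z′ → Cover P c (λ z → Z z ⊎ Z′ z)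
    cover-⊎ (ps , h) (qs , g) = ps ++ qs , λ where
      z (inj₁ p) → ++⁺ˡ (h z p)
      z (inj₂ p) → ++⁺ʳ ps (g z p)

    cover-∈ : ∀ {A : Set} {Z : A → Tr → Set} (xs : List A) → (∀ {a} → a ∈ xs → Cover P c (Z a)) →
              Cover P c (λ z → Any (λ a → Z a z) xs)
    cover-∈ []       f = cover-∅ λ _ ()
    cover-∈ (x ∷ xs) f = cover-⊆ (λ { z (here p) → inj₁ p ; z (there p) → inj₂ p })
                                 (cover-⊎ (f (here refl)) (cover-∈ xs (f ∘ there)))

    cover-Any : ∀ {A : Set} {Z : A → Tr → Set} (xs : List A) → (∀ a → Cover P c (Z a)) → Cover P c (λ z → Any (λ a → Z a z) xs)
    cover-Any xs f = cover-∈ xs (λ {a} _ → f a)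

    cover-∃ : ∀ {A : Set} {Z : A → Tr → Set} → Finite A → (∀ a → Cover P c (Z a)) → Cover P c (λ z → ∃ λ a → Z a z)
    cover-∃ {Z = Z} F f = cover-⊆
      (λ z (a , p) → tabulate⁺ (enc F a) (subst (λ a → Z a z) (sym (dec-enc F a)) p)) (cover-Any (Finite.elems F) f)

    cover-piece : ∀ {Z : Tr → Set} (p : Piece P c) → (∀ z → Z z → z ∈ᵣ set p) → Cover P c Z
    cover-piece p f = p ∷ [] , λ z q → here (f z q)

  reg-τˡ : ∀ {R : Q → Set} x → (∀ q → Dec (R q)) → RegSet (λ w → R (τ w x))
  reg-τˡ {R} x R? = reg-iff (λ { (w ∷ []) → id }) (λ { (w ∷ []) → id })
    (reg-sec x (reg-alg {P = R} finFin (reA (i1 ∷ i0 ∷ []) τA) R?))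

  reg-τʳ : ∀ {R : Q → Set} x → (∀ q → Dec (R q)) → RegSet (λ w → R (τ x w))
  reg-τʳ {R} x R? = reg-iff (λ { (w ∷ []) → id }) (λ { (w ∷ []) → id })
    (reg-sec x (reg-alg {P = R} finFin (reA (i0 ∷ i1 ∷ []) τA) R?))

  boxA : Fin s → (W V : RSet) → Alg 1 (Fin (Rel.size W) × Fin (Rel.size V) × Bool)
  boxA a W V = record
    { φ   = λ { (t ∷ []) → φ (alg W) (t ∷ []) , φ (alg V) (t ∷ []) , inBox t }
    ; δ   = λ { (m ∷ []) (p , q , _) (p′ , q′ , _) → Alg.δ (alg W) (m ∷ []) p p′ , Alg.δ (alg V) (m ∷ []) q q′ , flag m p q′ }
    ; hom = λ { (t ∷ []) → cong₂ _,_ (hom (alg W) _) (cong₂ _,_ (hom (alg V) _) (flag-eq t)) } }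
    where
    flag : Maybe (Fin s) → Fin (Rel.size W) → Fin (Rel.size V) → Bool
    flag nothing  p q = false
    flag (just b) p q = does (b ≟F a) ∧ out W p ∧ out V q
    inBox : Tr → Bool
    inBox t = flag (rt t) (φ (alg W) (lf t ∷ [])) (φ (alg V) (rg t ∷ []))
    flag-eq : ∀ t → inBox t ≡ flag (rt t) (φ (alg W) (lf t ∷ [])) (φ (alg V) (rg t ∷ []))
    flag-eq t = refl

  InBox : (Tr → Tr → Tr) → RSet → RSet → Tr → Set
  InBox N W V t = ∃₂ λ l r → t ≡ N l r × l ∈ᵣ W × r ∈ᵣ V

  reg-box : ∀ a W V → RegSet (InBox (node a) W V)
  reg-box a W V = reg-iff (λ { (t ∷ []) → to t }) (λ { (t ∷ []) → from t })
    (reg-alg {P = λ (_ , _ , b) → T b} (fin× finFin (fin× finFin finBool)) (boxA a W V) (λ _ → T? _))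
    where
    to : ∀ t → T (proj₂ (proj₂ (φ (boxA a W V) (t ∷ [])))) → InBox (node a) W V t
    to (node b l r) h with b ≟F a | out W (φ (alg W) (l ∷ [])) in e | out V (φ (alg V) (r ∷ [])) in f
    ... | yes refl | true | true = l , r , refl , mem (subst T (sym e) tt) , mem (subst T (sym f) tt)
    from : ∀ t → InBox (node a) W V t → T (proj₂ (proj₂ (φ (boxA a W V) (t ∷ []))))
    from .(node a l r) (l , r , refl , mem p , mem q) with a ≟F a | out W (φ (alg W) (l ∷ [])) | out V (φ (alg V) (r ∷ []))
    ... | yes _ | true | true = tt
    ... | no ne | _    | _    = ne refl

  reg-single : ∀ t → RegSet (_≡ t)
  reg-single leaf = reg-iff (λ { (leaf ∷ []) _ → refl ; (node _ _ _ ∷ []) () }) (λ { (leaf ∷ []) _ → tt ; (node _ _ _ ∷ []) () })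
    (reg-alg {P = T} finBool A T?)
    where
    A : Alg 1 Bool
    A = record
      { φ   = λ { (t ∷ []) → isLeaf (rt t) }
      ; δ   = λ { (m ∷ []) _ _ → isLeaf m }
      ; hom = λ { (t ∷ []) → refl } }
  reg-single (node a l r) = reg-iff
    (λ { (t ∷ []) (l′ , r′ , e , p , q) → trans e (cong₂ (node a) (∈⇒ (reg-single l) p) (∈⇒ (reg-single r) q)) })
    (λ { (t ∷ []) e → l , r , e , ∈⇐ (reg-single l) refl , ∈⇐ (reg-single r) refl })
    (reg-box a (rel (reg-single l)) (rel (reg-single r)))

  cover-single : ∀ {k P} {c : Vec ℕ k} t → zeros k ≺ c → Cover P c (_≡ t)
  cover-single t lt = cover-piece (piece lt (rel (reg-single t))
    (point λ p q → trans (∈⇒ (reg-single t) p) (sym (∈⇒ (reg-single t) q))))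
    λ z e → ∈⇐ (reg-single t) e

  -- Up to the order of the arguments of node, so that one proof serves both coordinates (flip).
  record Pairing : Set where
    field
      N     : Tr → Tr → Tr
      g     : Q → Q → Q
      τ-N   : ∀ l r l′ r′ → τ (N l r) (N l′ r′) ≡ g (τ l l′) (τ r r′)
      box   : RSet → RSet → RSet
      ∈box⇒ : ∀ {W V} t → t ∈ᵣ box W V → InBox N W V t
      ∈box⇐ : ∀ {W V} l r → l ∈ᵣ W → r ∈ᵣ V → N l r ∈ᵣ box W V

  nodeP : Fin s → Pairing
  nodeP a = record
    -- The diagonal component of the transition of `ηA` at `just a` is `δM (just a , just a)`, the
    -- transition at two roots labelled a.
    { N = node a ; g = λ q q′ → proj₂ (proj₂ (Alg.δ ηA (just a ∷ []) (q , q , q) (q′ , q′ , q′)))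
    ; τ-N = λ _ _ _ _ → refl
    ; box   = λ W V → rel (reg-box a W V)
    ; ∈box⇒ = λ {W} {V} t → ∈⇒ (reg-box a W V)
    ; ∈box⇐ = λ {W} {V} l r p q → ∈⇐ (reg-box a W V) (l , r , refl , p , q) }

  flip : Pairing → Pairing
  flip B = record
    { N = λ r l → N l r ; g = λ q′ q → g q q′ ; τ-N = λ r l r′ l′ → τ-N l r l′ r′
    ; box   = λ V W → box W V
    ; ∈box⇒ = λ t p → let (l , r , e , pl , pr) = ∈box⇒ t p in r , l , e , pr , pl
    ; ∈box⇐ = λ r l p q → ∈box⇐ l r q p }
    where open Pairing B

  -- C lists the colours d such that some step inside W may make up for a loss of colour d
  -- in the other coordinate; likewise D for V.
  record Factors {k} (B : Pairing) (P PX PY : Pr) (α β : Vec ℕ (suc k)) (X Y W V : RSet) (C D : List Q) : Set where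
    open Pairing B
    field
      lin   : Lin (_∈ᵣ box W V) P
      upX   : ∀ {l l′} r → r ∈ᵣ V → l ≤[ PX ] l′ → N l r ≤[ P ] N l′ r
      downX : ∀ {l l′} r → r ∈ᵣ V → N l r ≤[ P ] N l′ r → l ≤[ PX ] l′
      upY   : ∀ {r r′} l → l ∈ᵣ W → r ≤[ PY ] r′ → N l r ≤[ P ] N l r′
      downY : ∀ {r r′} l → l ∈ᵣ W → N l r ≤[ P ] N l r′ → r ≤[ PY ] r′
      thinX : Thin PX α X
      thinY : Thin PY β Y
      W⊆X   : ∀ {t} → t ∈ᵣ W → t ∈ᵣ X
      V⊆Y   : ∀ {t} → t ∈ᵣ V → t ∈ᵣ Y
      colC  : ∀ {w w′ v d} → w ∈ᵣ W → w′ ∈ᵣ W → v ∈ᵣ V → T (lookup P (g (τ w w′) d)) → d ∈ C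
      colD  : ∀ {v v′ w d} → v ∈ᵣ V → v′ ∈ᵣ V → w ∈ᵣ W → T (lookup P (g d (τ v v′))) → d ∈ D

  flipF : ∀ {k B P PX PY} {α β : Vec ℕ (suc k)} {X Y W V C D} →
          Factors B P PX PY α β X Y W V C D → Factors (flip B) P PY PX β α Y X V W D C
  flipF F = record
    { lin = lin ; upX = upY ; downX = downY ; upY = upX ; downY = downX ; thinX = thinY ; thinY = thinX
    ; W⊆X = V⊆Y ; V⊆Y = W⊆X ; colC = colD ; colD = colC }
    where open Factors F

  reg-∩ : ∀ X Y → RegSet (λ t → t ∈ᵣ X × t ∈ᵣ Y)
  reg-∩ X Y = reg-× (reg-∈ X) (reg-∈ Y)

  _∩_ : RSet → RSet → RSet
  X ∩ Y = rel (reg-∩ X Y)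

  ∈∩⇒ : ∀ X Y {t} → t ∈ᵣ X ∩ Y → t ∈ᵣ X × t ∈ᵣ Y
  ∈∩⇒ X Y = ∈⇒ (reg-∩ X Y)

  ∈∩⇐ : ∀ X Y {t} → t ∈ᵣ X → t ∈ᵣ Y → t ∈ᵣ X ∩ Y
  ∈∩⇐ X Y p q = ∈⇐ (reg-∩ X Y) (p , q)

  Rec : ∀ {k} → Pr → Vec ℕ (suc k) → Set
  Rec {k} P c = ∀ {B PX PY} {α β : Vec ℕ (suc k)} {X Y W V C D} → Factors B P PX PY α β X Y W V C D →
    boxRank α β (length C) (length D) ≺ c → Thin P (boxRank α β (length C) (length D)) (Pairing.box B W V)

  module Box {k B P PX PY} {α β : Vec ℕ (suc k)} {X Y W V C D} (F : Factors B P PX PY α β X Y W V C D)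
             (recur : Rec P (boxRank α β (length C) (length D))) where
    open Pairing B
    open Factors F
    open Lin lin

    c : Vec ℕ (suc k)
    c = boxRank α β (length C) (length D)

    ≤⇒ : ∀ {l r l′ r′} → N l r ≤[ P ] N l′ r′ → T (lookup P (g (τ l l′) (τ r r′)))
    ≤⇒ {l} {r} {l′} {r′} p = subst (T ∘ lookup P) (τ-N l r l′ r′) (eval p)

    ≤⇐ : ∀ {l r l′ r′} → T (lookup P (g (τ l l′) (τ r r′))) → N l r ≤[ P ] N l′ r′
    ≤⇐ {l} {r} {l′} {r′} p = le (subst (T ∘ lookup P) (sym (τ-N l r l′ r′)) p)

    sub-Factors : ∀ {W′ V′} → (∀ {t} → t ∈ᵣ W′ → t ∈ᵣ W) → (∀ {t} → t ∈ᵣ V′ → t ∈ᵣ V) → ∀ C′ →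
      (∀ {w w′ v d} → w ∈ᵣ W′ → w′ ∈ᵣ W′ → v ∈ᵣ V′ → T (lookup P (g (τ w w′) d)) → d ∈ C′) →
      ∀ {α′ X′} → Thin PX α′ X′ → (∀ {t} → t ∈ᵣ W′ → t ∈ᵣ X′) → Factors B P PX PY α′ β X′ Y W′ V′ C′ D
    sub-Factors f h C′ col th g = record
      { lin = lin-⊆ (λ {t} p → let (l , r , e , pl , pr) = ∈box⇒ t p in
                       subst (_∈ᵣ box W V) (sym e) (∈box⇐ l r (f pl) (h pr))) lin
      ; upX = λ r p → upX r (h p) ; downX = λ r p → downX r (h p)
      ; upY = λ l p → upY l (f p) ; downY = λ l p → downY l (f p)
      ; thinX = th ; thinY = thinY ; W⊆X = g ; V⊆Y = V⊆Y ∘ h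
      ; colC = col ; colD = λ p q r → colD (h p) (h q) (f r) }

    module _ {x x′ y} (x∈ : x ∈ᵣ W) (x′∈ : x′ ∈ᵣ W) (y∈ : y ∈ᵣ V) where

      Gain : Q → Tr → Tr → Set
      Gain d w w′ = T (lookup P (g (τ w w′) d))

      drop : Q → List Q
      drop d = List.filter (λ e → ¬? (e ≟F d)) C

      drop-< : ∀ {d} → d ∈ C → length (drop d) < length C
      drop-< d∈ = filter-notAll _ C (Any.map (λ e ne → ne (sym e)) d∈)

      -- Restricting W and V keeps the ambient X and Y with their ranks α and β. Progress comes from
      -- the colour d alone: no step inside the smaller W gains it, so it leaves C.
      coloured : ∀ {W′ V′ : Tr → Set} {d} → d ∈ C → (RW : RegSet W′) (RV : RegSet V′) →
        (∀ {w w′ v} → w ∈ᵣ W → w′ ∈ᵣ W → v ∈ᵣ V → W′ w → W′ w′ → V′ v → ¬ Gain d w w′) →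
        Cover P c (InBox N (W ∩ rel RW) (V ∩ rel RV))
      coloured {d = d} d∈ RW RV forb = cover-piece
        (piece (⊕-monoʳ (α ⊕ β) (fin-mono k (s≤s (ℕₚ.+-monoˡ-< (length D) (drop-< d∈)))))
               (box (W ∩ rel RW) (V ∩ rel RV))
               (recur (sub-Factors (proj₁ ∘ ∈∩⇒ W (rel RW)) (proj₁ ∘ ∈∩⇒ V (rel RV)) (drop d) col thinX (W⊆X ∘ proj₁ ∘ ∈∩⇒ W (rel RW)))
                      (⊕-monoʳ (α ⊕ β) (fin-mono k (s≤s (ℕₚ.+-monoˡ-< (length D) (drop-< d∈)))))))
        λ z (l , r , e , p , q) → subst (_∈ᵣ box _ _) (sym e) (∈box⇐ l r p q)
        where
        col : ∀ {w w′ v e} → w ∈ᵣ W ∩ rel RW → w′ ∈ᵣ W ∩ rel RW → v ∈ᵣ V ∩ rel RV → Gain e w w′ → e ∈ drop d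
        col p p′ q θ with ∈∩⇒ W (rel RW) p | ∈∩⇒ W (rel RW) p′ | ∈∩⇒ V (rel RV) q
        ... | w∈ , w | w′∈ , w′ | v∈ , v = ∈-filter⁺ _ (colC w∈ w′∈ v∈ θ) λ where
              refl → forb w∈ w′∈ v∈ (∈⇒ RW w) (∈⇒ RW w′) (∈⇒ RV v) θ

      -- Below x: if colour d lets w beat the step to x′ but not the step to x, no two such w differ by d.
      lowW upW : Q → Tr → Set
      lowW d w = w ≤[ PX ] x × ¬ Gain d w x × Gain d w x′
      upW  d w = x′ ≤[ PX ] w × Gain d x w × ¬ Gain d x′ w

      lowV upV : Q → Tr → Set
      lowV d v = τ v y ≡ d
      upV  d v = τ y v ≡ d

      reg-low : ∀ d → RegSet (lowW d)
      reg-low d = reg-iff (λ _ → λ { (p , q , r) → le p , q , r }) (λ _ → λ { (p , q , r) → eval p , q , r })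
        (reg-× (reg-τˡ {λ q → T (lookup PX q)} x λ _ → T? _)
        (reg-× (reg-τˡ {λ q → ¬ T (lookup P (g q d))} x λ _ → ¬? (T? _))
               (reg-τˡ {λ q → T (lookup P (g q d))} x′ λ _ → T? _)))

      reg-up : ∀ d → RegSet (upW d)
      reg-up d = reg-iff (λ _ → λ { (p , q , r) → le p , q , r }) (λ _ → λ { (p , q , r) → eval p , q , r })
        (reg-× (reg-τʳ {λ q → T (lookup PX q)} x′ λ _ → T? _)
        (reg-× (reg-τʳ {λ q → T (lookup P (g q d))} x λ _ → T? _)
               (reg-τʳ {λ q → ¬ T (lookup P (g q d))} x′ λ _ → ¬? (T? _))))

      reg-lowV : ∀ d → RegSet (lowV d)
      reg-lowV d = reg-τˡ {_≡ d} y (_≟F d)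

      reg-upV : ∀ d → RegSet (upV d)
      reg-upV d = reg-τʳ {_≡ d} y (_≟F d)

      ∈N : ∀ {l r} → l ∈ᵣ W → r ∈ᵣ V → N l r ∈ᵣ box W V
      ∈N = ∈box⇐ _ _

      low-forbids : ∀ d {w w′ v} → w ∈ᵣ W → w′ ∈ᵣ W → v ∈ᵣ V → lowW d w → lowW d w′ → lowV d v → ¬ Gain d w w′
      low-forbids d {w} {w′} {v} w∈ w′∈ v∈ (_ , ¬θ , _) (w′≤x , _) refl θ =
        ¬θ (≤⇒ {w} {v} {x} {y} (≤-trans (∈N w∈ v∈) (∈N w′∈ y∈) (∈N x∈ y∈) (≤⇐ θ) (upX y y∈ w′≤x)))

      up-forbids : ∀ d {w w′ v} → w ∈ᵣ W → w′ ∈ᵣ W → v ∈ᵣ V → upW d w → upW d w′ → upV d v → ¬ Gain d w w′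
      up-forbids d {w} {w′} {v} w∈ w′∈ v∈ (x′≤w , _) (_ , _ , ¬θ) refl θ =
        ¬θ (≤⇒ {x′} {y} {w′} {v} (≤-trans (∈N x′∈ y∈) (∈N w∈ y∈) (∈N w′∈ v∈) (upX y y∈ x′≤w) (≤⇐ θ)))

      Inside : (W′ V′ : Tr → Set) → Tr → Set
      Inside W′ V′ z = ∃₂ λ w v → z ≡ N w v × (w ∈ᵣ W × W′ w) × (v ∈ᵣ V × V′ v)

      -- If d is not in C there is nothing to cover, since any member would itself witness that d is
      -- in C.
      cover-colour : ∀ {W′ V′ : Tr → Set} d → (RW : RegSet W′) (RV : RegSet V′) →
        (∀ {w} → w ∈ᵣ W → W′ w → ∀ {v} → v ∈ᵣ V → d ∈ C) →
        (∀ {w w′ v} → w ∈ᵣ W → w′ ∈ᵣ W → v ∈ᵣ V → W′ w → W′ w′ → V′ v → ¬ Gain d w w′) →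
        Cover P c (Inside W′ V′)
      cover-colour d RW RV used forb with mem? _≟F_ d C
      ... | no d∉  = cover-∅ λ { z (w , v , _ , (w∈ , w′) , (v∈ , _)) → d∉ (used w∈ w′ v∈) }
      ... | yes d∈ = cover-⊆ (λ { z (w , v , e , (w∈ , w′) , (v∈ , v′)) → w , v , e ,
                                  ∈∩⇐ W (rel RW) w∈ (∈⇐ RW w′) , ∈∩⇐ V (rel RV) v∈ (∈⇐ RV v′) })
                             (coloured d∈ RW RV forb)

      Mid : Tr → Set
      Mid w = x ≤[ PX ] w × w ≤[ PX ] x′

      InMid : Tr → Set
      InMid z = z ≤[ P ] N x′ y × N x y ≤[ P ] z × ∃₂ λ w v → z ≡ N w v × (w ∈ᵣ W × Mid w) × v ∈ᵣ V

      -- Here the rank of the first factor drops: the part of X between x and x′ splits into pieces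
      -- of rank below α, with the colours unchanged. If X has at most one member, then x and x′
      -- agree and only `N x y` is left.
      cover-mid : Cover P c (λ z → z ≡ N x y ⊎ InMid z)
      cover-mid with thinX
      ... | point f = cover-⊆
            (λ { z (inj₁ e) → e
               ; z (inj₂ (p , q , w , v , refl , (w∈ , _) , v∈)) → ≤-antisym (∈N w∈ v∈) (∈N x∈ y∈)
                   (subst (λ u → N w v ≤[ P ] N u y) (f (W⊆X x′∈) (W⊆X x∈)) p) q })
            (cover-single (N x y) (zeros≺⊕fin (α ⊕ β) _))
      ... | covered f = cover-⊎ (cover-single (N x y) (zeros≺⊕fin (α ⊕ β) _))
            (cover-⊆ (λ { z (_ , _ , w , v , e , (w∈ , x≤w , w≤x′) , v∈) → Any.map
                            (λ {q} w∈X′ → w , v , e , ∈∩⇐ W (set q) w∈ w∈X′ , v∈)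
                            (proj₂ (f (W⊆X x∈) (W⊆X x′∈)) w (W⊆X w∈) x≤w w≤x′) })
              (cover-Any (proj₁ (f (W⊆X x∈) (W⊆X x′∈))) λ q → let lt = ⊕-monoˡ (fin k _) (⊕-monoˡ β (below q)) in
                 cover-piece (piece lt (box (W ∩ set q) V)
                   (recur (sub-Factors (proj₁ ∘ ∈∩⇒ W (set q)) id C (λ p p′ → colC (proj₁ (∈∩⇒ W (set q) p)) (proj₁ (∈∩⇒ W (set q) p′)))
                                       (thin q) (proj₂ ∘ ∈∩⇒ W (set q))) lt))
                   λ z (w , v , e , w∈ , v∈) → subst (_∈ᵣ box _ _) (sym e) (∈box⇐ w v w∈ v∈)))

      Low Up Part : Tr → Set
      Low z  = ∃ λ d → Inside (lowW d) (lowV d) z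
      Up z   = ∃ λ d → Inside (upW d) (upV d) z
      Part z = z ≡ N x′ y ⊎ Low z ⊎ Up z ⊎ (z ≡ N x y ⊎ InMid z)

      -- Only the first coordinate of the endpoints changes. Write z as `N w v` and compare w with x
      -- and x′. Between them, `cover-mid` applies. Outside, z stays in the interval only because
      -- the change between v and y makes up for the excess of w; its colour then puts z into `Low`
      -- or `Up`, or else z is an endpoint.
      cover-step : Cover P c (λ z → z ∈ᵣ box W V × N x y ≤[ P ] z × z ≤[ P ] N x′ y)
      cover-step = cover-⊆ locate
        (cover-⊎ (cover-single (N x′ y) (zeros≺⊕fin (α ⊕ β) _))
        (cover-⊎ (cover-∃ finFin λ d → cover-colour d (reg-low d) (reg-lowV d)
                     (λ w∈ (_ , _ , θ) v∈ → colC w∈ x′∈ v∈ θ) (low-forbids d))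
        (cover-⊎ (cover-∃ finFin λ d → cover-colour d (reg-up d) (reg-upV d)
                     (λ w∈ (_ , θ , _) v∈ → colC x∈ w∈ v∈ θ) (up-forbids d))
                 cover-mid)))
        where
        locate : ∀ z → z ∈ᵣ box W V × N x y ≤[ P ] z × z ≤[ P ] N x′ y → Part z
        locate z (z∈ , p , q) with ∈box⇒ z z∈
        ... | w , v , refl , w∈ , v∈ with ≤-total (∈N w∈ y∈) (∈N x∈ y∈) | ≤-total (∈N w∈ y∈) (∈N x′∈ y∈)
        ...   | inj₂ x≤w | inj₁ w≤x′ = inj₂ (inj₂ (inj₂ (inj₂ (q , p , w , v , refl , (w∈ , downX y y∈ x≤w , downX y y∈ w≤x′) , v∈))))
        ...   | inj₁ w≤x | _ with N w v ≤[ P ]? N x y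
        ...     | yes r = inj₂ (inj₂ (inj₂ (inj₁ (≤-antisym z∈ (∈N x∈ y∈) r p))))
        ...     | no ¬r = inj₂ (inj₁ (τ v y , w , v , refl , (w∈ , downX y y∈ w≤x , ¬r ∘ ≤⇐ , ≤⇒ q) , (v∈ , refl)))
        locate z (z∈ , p , q) | w , v , refl , w∈ , v∈ | inj₂ _ | inj₂ x′≤w with N x′ y ≤[ P ]? N w v
        ...     | yes r = inj₁ (≤-antisym z∈ (∈N x′∈ y∈) q r)
        ...     | no ¬r = inj₂ (inj₂ (inj₁ (τ y v , w , v , refl , (w∈ , downX y y∈ x′≤w , ≤⇒ p , ¬r ∘ ≤⇐) , (v∈ , refl))))

  box-thin′ : ∀ {k B P PX PY} {α β : Vec ℕ (suc k)} {X Y W V C D} → Acc _≺_ (boxRank α β (length C) (length D)) →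
              Factors B P PX PY α β X Y W V C D → Thin P (boxRank α β (length C) (length D)) (Pairing.box B W V)
  box-thin′ {k} {B} {P} {PX} {PY} {α} {β} {X} {Y} {W} {V} {C} {D} (acc rs) F = covered between
    where
    open Pairing B
    open Factors F
    open Lin lin
    c = boxRank α β (length C) (length D)
    recur : Rec P c
    recur F′ lt = box-thin′ (rs lt) F′
    recur′ : Rec P (boxRank β α (length D) (length C))
    recur′ F′ lt = recur F′ (subst (_ ≺_) (boxRank-comm α β (length C) (length D)) lt)
    between : ∀ {t t′} → t ∈ᵣ box W V → t′ ∈ᵣ box W V → Σ (List (Piece P c)) λ ps →
              ∀ z → z ∈ᵣ box W V → t ≤[ P ] z → z ≤[ P ] t′ → Any (λ p → z ∈ᵣ set p) ps
    between {t} {t′} t∈ t′∈ with ∈box⇒ t t∈ | ∈box⇒ t′ t′∈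
    ... | x , y , refl , x∈ , y∈ | x′ , y′ , refl , x′∈ , y′∈ = proj₁ both , λ z z∈ p q → proj₂ both z (split z z∈ p q)
      where
      -- Change one coordinate at a time, via the corner `N x′ y`. The corner need not lie between
      -- the endpoints: by totality each z is on one side of it, which is all that `split` uses.
      both : Cover P c λ z → (z ∈ᵣ box W V × N x y ≤[ P ] z × z ≤[ P ] N x′ y)
                           ⊎ (z ∈ᵣ box W V × N x′ y ≤[ P ] z × z ≤[ P ] N x′ y′)
      both = cover-⊎ (Box.cover-step F recur x∈ x′∈ y∈)
        (subst (λ c → Cover P c λ z → z ∈ᵣ box W V × N x′ y ≤[ P ] z × z ≤[ P ] N x′ y′)
               (boxRank-comm α β (length C) (length D)) (Box.cover-step (flipF F) recur′ y∈ y′∈ x′∈))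
      split : ∀ z → z ∈ᵣ box W V → N x y ≤[ P ] z → z ≤[ P ] N x′ y′ → _
      split z z∈ p q with ≤-total z∈ (∈box⇐ _ _ x′∈ y∈)
      ... | inj₁ r = inj₁ (z∈ , p , r)
      ... | inj₂ r = inj₂ (z∈ , r , q)

  box-thin : ∀ {k B P PX PY} {α β : Vec ℕ (suc k)} {X Y W V C D} → Factors B P PX PY α β X Y W V C D →
             Thin P (boxRank α β (length C) (length D)) (Pairing.box B W V)
  box-thin = box-thin′ (≺-wf _)

-- Rank bounds for basics and for intervals of E

ω : ∀ k → Vec ℕ (suc k)
ω k = 1 ∷ zeros k

¬≺zeros : ∀ {k} {a : Vec ℕ k} → ¬ a ≺ zeros k
¬≺zeros {suc k} (tl p) = ¬≺zeros p

below-ω : ∀ {k} (a : Vec ℕ k) → 0 ∷ a ≺ ω k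
below-ω a = hd (s≤s z≤n)

-- ω^(k+1) is closed under natural sums. The exponent is at least 1, so the finite number of colours
-- is absorbed too.
boxRank-below : ∀ {k} {α β : Vec ℕ (suc (suc k))} → α ≺ ω (suc k) → β ≺ ω (suc k) → ∀ m n → boxRank α β m n ≺ ω (suc k)
boxRank-below {α = _ ∷ _} {_ ∷ _} (hd (s≤s z≤n)) (hd (s≤s z≤n)) m n = below-ω _
boxRank-below {α = _ ∷ _} {_ ∷ _} (hd _) (tl q) m n = contradiction q ¬≺zeros
boxRank-below {α = _ ∷ _} {_ ∷ _} (tl p) _      m n = contradiction p ¬≺zeros

module Soundness (s : ℕ) (M : TreeAutomaton (Maybe (Fin s) × Maybe (Fin s))) where

  open Engine s
  open Types s M
  open Covers s M

  lift : ∀ {k P X} {c : Vec ℕ k} → Acc _≺_ c → Thin P c X → Thin P (0 ∷ c) X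
  lift _ (point f) = point f
  lift {P = P} {c = c} (acc rs) (covered f) = covered λ p q →
      List.map up (proj₁ (f p q)) , λ z z∈ t≤ ≤t′ → map⁺ (proj₂ (f p q) z z∈ t≤ ≤t′)
    where
    up : Piece P c → Piece P (0 ∷ c)
    up p = piece (tl (below p)) (set p) (lift (rs (below p)) (thin p))

  cover-map : ∀ {k k′} {c : Vec ℕ k} {c′ : Vec ℕ k′} {P Z} (f : Piece P c → Piece P c′) → (∀ p → set (f p) ≡ set p) →
              Cover P c Z → Cover P c′ Z
  cover-map f e (ps , h) = List.map f ps , λ z p → map⁺ (Any.map (λ {q} → subst (z ∈ᵣ_) (sym (e q))) (h z p))

  cover-lift : ∀ {k P Z} {c : Vec ℕ k} → Cover P c Z → Cover P (0 ∷ c) Z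
  cover-lift = cover-map (λ p → piece (tl (below p)) (set p) (lift (≺-wf _) (thin p))) (λ _ → refl)

  cover-raise : ∀ {k P Z} → Cover P (ω k) Z → Cover P (ω (suc k)) Z
  cover-raise = cover-map (λ p → piece (below-ω _) (set p) (lift (≺-wf _) (thin p))) (λ _ → refl)

  reg-ty : ∀ x y θ → RegSet (λ z → ty x y z ≡ θ)
  reg-ty x y θ = reg-iff (λ { (z ∷ []) → id }) (λ { (z ∷ []) → id })
    (reg-sec y (reg-sec x (reg-alg {P = _≡ θ} finΘ tyA (λ c → Finite._≟_ finΘ c θ))))

  ty? : ∀ x y θ → Dec (∃ λ z → ty x y z ≡ θ)
  ty? x y θ = decide (reg-∃ (reg-ty x y θ)) []

  Ty : Tr → Tr → Θ → Tr → Set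
  Ty x y θ z = ty x y z ≡ θ

  module _ {k : ℕ} (x y : Tr) (θ : Θ) (P : Pr) (lin : Lin (Ty x y θ) P) where

    Tyₗ Tyᵣ : Tr → Tr → Set
    Tyₗ l = Ty (lf x) (lf y) (ty (lf x) (lf y) l)
    Tyᵣ r = Ty (rg x) (rg y) (ty (rg x) (rg y) r)

    module _ (H₀ : ∀ a l r → ty x y (node a l r) ≡ θ → Lin (Tyₗ l) (cL a (dg (η r)) P) →
                   Cover (cL a (dg (η r)) P) (ω (suc k)) (Tyₗ l))
             (H₁ : ∀ a l r → ty x y (node a l r) ≡ θ → Lin (Tyᵣ r) (cR a (dg (η l)) P) →
                   Cover (cR a (dg (η l)) P) (ω (suc k)) (Tyᵣ r)) where

      module _ (a : Fin s) (l₀ r₀ : Tr) (e : ty x y (node a l₀ r₀) ≡ θ) where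

        PX = cL a (dg (η r₀)) P
        PY = cR a (dg (η l₀)) P

        regL = reg-ty (lf x) (lf y) (ty (lf x) (lf y) l₀)
        regR = reg-ty (rg x) (rg y) (ty (rg x) (rg y) r₀)

        RL RR : RSet
        RL = rel regL
        RR = rel regR

        typed : ∀ {l r} → Tyₗ l₀ l → Tyᵣ r₀ r → ty x y (node a l r) ≡ θ
        typed p q = trans (node-ty x y a p q) e

        -- All trees in `RL` share the type of l₀ and all in `RR` that of r₀. Hence the diagonal
        -- values agree throughout the box, and `PX` and `PY` do not depend on the tree in the other
        -- coordinate. Initially every state counts as a colour.
        factors : ∀ (p : Piece PX (ω (suc k))) (q : Piece PY (ω (suc k))) → Factors (nodeP a) P PX PY (rank p) (rank q)
          (set p) (set q) (RL ∩ set p) (RR ∩ set q)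
          (List.allFin (TreeAutomaton.states M)) (List.allFin (TreeAutomaton.states M))
        factors p q = record
          { lin   = lin-⊆ (λ {t} h → let (l , r , eq , l∈ , r∈) = ∈⇒ (reg-box a (RL ∩ set p) (RR ∩ set q)) h in
                             subst (Ty x y θ) (sym eq) (typed (tyL l∈) (tyR r∈))) lin
          ; upX   = λ {l} {l′} r r∈ h → ≤-plug (inl a hole r) P (subst (λ h → l ≤[ cL a (dg h) P ] l′) (sym (ηR r∈)) h)
          ; downX = λ {l} {l′} r r∈ h → subst (λ h → l ≤[ cL a (dg h) P ] l′) (ηR r∈) (≤-unplug (inl a hole r) P h)
          ; upY   = λ {r} {r′} l l∈ h → ≤-plug (inr a l hole) P (subst (λ h → r ≤[ cR a (dg h) P ] r′) (sym (ηL l∈)) h)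
          ; downY = λ {r} {r′} l l∈ h → subst (λ h → r ≤[ cR a (dg h) P ] r′) (ηL l∈) (≤-unplug (inr a l hole) P h)
          ; thinX = thin p ; thinY = thin q
          ; W⊆X = proj₂ ∘ ∈∩⇒ RL (set p) ; V⊆Y = proj₂ ∘ ∈∩⇒ RR (set q)
          ; colC = λ _ _ _ _ → ∈-allFin _ ; colD = λ _ _ _ _ → ∈-allFin _ }
          where
          tyL : ∀ {l} → l ∈ᵣ RL ∩ set p → Tyₗ l₀ l
          tyL h = ∈⇒ regL (proj₁ (∈∩⇒ RL (set p) h))
          tyR : ∀ {r} → r ∈ᵣ RR ∩ set q → Tyᵣ r₀ r
          tyR h = ∈⇒ regR (proj₁ (∈∩⇒ RR (set q) h))
          ηL : ∀ {l} → l ∈ᵣ RL ∩ set p → η l ≡ η l₀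
          ηL h = cong tyη (tyL h)
          ηR : ∀ {r} → r ∈ᵣ RR ∩ set q → η r ≡ η r₀
          ηR h = cong tyη (tyR h)

        box-piece : Piece PX (ω (suc k)) → Piece PY (ω (suc k)) → Piece P (ω (suc k))
        box-piece p q = piece (boxRank-below (below p) (below q) (length colours) (length colours)) (box (RL ∩ set p) (RR ∩ set q)) (box-thin (factors p q))
          where
          open Pairing (nodeP a)
          colours = List.allFin (TreeAutomaton.states M)

        InBox₀ : Tr → Set
        InBox₀ z = ∃₂ λ l r → z ≡ node a l r × Tyₗ l₀ l × Tyᵣ r₀ r

        in-piece : ∀ p q z → (∃₂ λ l r → z ≡ node a l r × (Tyₗ l₀ l × l ∈ᵣ set p) × (Tyᵣ r₀ r × r ∈ᵣ set q)) → z ∈ᵣ set (box-piece p q)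
        in-piece p q _ (l , r , refl , (p∈ , l∈) , (q∈ , r∈)) =
          ∈box⇐ l r (∈∩⇐ RL (set p) (∈⇐ regL p∈) l∈) (∈∩⇐ RR (set q) (∈⇐ regR q∈) r∈)
          where open Pairing (nodeP a)

        cover-box : Cover P (ω (suc k)) InBox₀
        cover-box = cover-⊆
          (λ z (l , r , eq , p , q) → Any.map (λ l∈ → Any.map (λ r∈ → l , r , eq , (p , l∈) , (q , r∈)) (proj₂ CR r q)) (proj₂ CL l p))
          (cover-Any (proj₁ CL) λ p → cover-Any (proj₁ CR) λ q → cover-piece (box-piece p q) (in-piece p q))
          where
          CL : Cover PX (ω (suc k)) (Tyₗ l₀)
          CL = H₀ a l₀ r₀ e (lin-plug (inl a hole r₀) (λ p → typed p refl) lin)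
          CR : Cover PY (ω (suc k)) (Tyᵣ r₀)
          CR = H₁ a l₀ r₀ e (lin-plug (inr a l₀ hole) (λ q → typed refl q) lin)

      -- By `node-ty` the root label and the types of the children determine the type of the node.
      -- So apart from leaf the class is a finite union of full products, and covers of the two
      -- factors multiply to covers by boxes.
      cover-step : Cover P (ω (suc k)) (Ty x y θ)
      cover-step = cover-⊆ (λ { leaf p → inj₁ refl ; (node a l r) p → inj₂ (a , _ , _ , l , r , refl , refl , refl , p) })
        (cover-⊎ (cover-single leaf (below-ω _))
          (cover-∃ finFin λ a → cover-∃ finΘ λ θ₀ → cover-∃ finΘ λ θ₁ → by a θ₀ θ₁))
        where
        by : ∀ a θ₀ θ₁ → Cover P (ω (suc k)) λ z → ∃₂ λ l r → z ≡ node a l r ×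
               ty (lf x) (lf y) l ≡ θ₀ × ty (rg x) (rg y) r ≡ θ₁ × ty x y z ≡ θ
        by a θ₀ θ₁ with ty? (lf x) (lf y) θ₀ | ty? (rg x) (rg y) θ₁
        ... | no ¬l | _ = cover-∅ λ { z (l , _ , _ , p , _) → ¬l (l , p) }
        ... | yes _ | no ¬r = cover-∅ λ { z (_ , r , _ , _ , q , _) → ¬r (r , q) }
        ... | yes (l₀ , refl) | yes (r₀ , refl) with Finite._≟_ finΘ (ty x y (node a l₀ r₀)) θ
        ...   | yes e = cover-⊆ (λ { z (l , r , eq , p , q , _) → l , r , eq , p , q }) (cover-box a l₀ r₀ e)
        ...   | no ne = cover-∅ λ { z (l , r , refl , p , q , e) → ne (trans (sym (node-ty x y a p q)) e) }

  is : H → H → Bool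
  is p h = does (Finite._≟_ finH h p)

  is⇒ : ∀ {p t} → t ∈H is p → η t ≡ p
  is⇒ {p} {t} h = of-does (Finite._≟_ finH (η t) p) (type h)

  is⇐ : ∀ {p t} → η t ≡ p → t ∈H is p
  is⇐ {p} {t} e = inH (to-does (Finite._≟_ finH (η t) p) e)

  reg-is : ∀ p → RegSet (_∈H is p)
  reg-is p = reg-iff (λ { (t ∷ []) → inH }) (λ { (t ∷ []) → type }) (reg-alg {P = T ∘ is p} finH ηA (λ _ → T? _))

  -- `Lin` is a premise because G may also contain pairs for which P is not a linear order on the
  -- class; the basics that occur in a linear order inherit it through `lin-plug`. The exponent
  -- starts at 1 for the sake of `boxRank-below`.
  SoundAt : ℕ → (H → Pr → Bool) → Set
  SoundAt k G = ∀ {p P} → T (G p P) → Lin (_∈H is p) P → Cover P (ω (suc k)) (_∈H is p)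

  module Use {k : ℕ} (G : H → Pr → Bool) (S : SoundAt k G) where

    open Good G

    leafΘ : H → Θ
    leafΘ h@(p , q , _) = q , p , q , p , h

    cover-basic : ∀ {θ P} z → ty leaf leaf z ≡ θ → Basic (η z) P → Lin (Ty leaf leaf θ) P → Cover P (ω (suc k)) (Ty leaf leaf θ)
    cover-basic z refl b lin = cover-⊆ (λ t e → is⇐ (cong tyη e)) (S b (lin-⊆ (λ {t} h → cong leafΘ (is⇒ {t = t} h)) lin))

    -- Recursion over the domains of x and y. As long as one of them has a node, the class is built
    -- from the classes of the children; where both have ended it is a class of `η`, and `gd` at
    -- `hole` puts its basic into G.
    cover-ty : ∀ x y θ P → (∀ z → ty x y z ≡ θ → T (gd P x y z)) → Lin (Ty x y θ) P → Cover P (ω (suc k)) (Ty x y θ)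
    cover-ty-step : ∀ x y θ P →
      (∀ θ P → (∀ z → ty (lf x) (lf y) z ≡ θ → T (gd P (lf x) (lf y) z)) → Lin (Ty (lf x) (lf y) θ) P → Cover P (ω (suc k)) (Ty (lf x) (lf y) θ)) →
      (∀ θ P → (∀ z → ty (rg x) (rg y) z ≡ θ → T (gd P (rg x) (rg y) z)) → Lin (Ty (rg x) (rg y) θ) P → Cover P (ω (suc k)) (Ty (rg x) (rg y) θ)) →
      (∀ z → ty x y z ≡ θ → T (gd P x y z)) → Lin (Ty x y θ) P → Cover P (ω (suc k)) (Ty x y θ)
    cover-ty-step x y θ P I J g lin = cover-step x y θ P lin
      (λ a l r e → I _ _ λ z e′ → gd⇐ z λ K u eq → gd⇒ {P} {x} {y} (g (node a z r) (trans (node-ty x y a e′ refl) e))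
                                                    (inl a K r) (cong (λ t → node a t r) eq))
      (λ a l r e → J _ _ λ z e′ → gd⇐ z λ K u eq → gd⇒ {P} {x} {y} (g (node a l z) (trans (node-ty x y a refl e′) e))
                                                    (inr a l K) (cong (node a l) eq))
    cover-ty leaf leaf θ P g lin with ty? leaf leaf θ
    ... | yes (z , e) = cover-basic z e (gd⇒ {P} {leaf} {leaf} (g z e) hole {z} refl refl refl) lin
    ... | no ¬z = cover-∅ λ z e → ¬z (z , e)
    cover-ty x@leaf y@(node _ y₀ y₁) θ P = cover-ty-step x y θ P (cover-ty leaf y₀) (cover-ty leaf y₁)
    cover-ty x@(node _ x₀ x₁) y@leaf θ P = cover-ty-step x y θ P (cover-ty x₀ leaf) (cover-ty x₁ leaf)
    cover-ty x@(node _ x₀ x₁) y@(node _ y₀ y₁) θ P = cover-ty-step x y θ P (cover-ty x₀ y₀) (cover-ty x₁ y₁)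

    -- Lying in D and lying between x and y depend only on `ty x y z`, which takes finitely many
    -- values.
    cover-E : ∀ {D P x y} → E D P x y → Lin (_∈H D) P → Cover P (ω (suc k)) (λ z → z ∈H D × Btw P x y z)
    cover-E {D} {P} {x} {y} e lin = cover-⊆ (λ z (d , b) → ty x y z , refl , d , b) (cover-∃ finΘ by)
      where
      by : ∀ θ → Cover P (ω (suc k)) λ z → ty x y z ≡ θ × z ∈H D × Btw P x y z
      by θ with T? (D (tyη θ)) | btwΘ? P θ
      ... | yes d | yes b = cover-⊆ (λ z → proj₁) (cover-ty x y θ P
              (λ { z refl → e z (inH d) (Θ⇒btw P x y z b) }) (lin-⊆ (λ { refl → inH d }) lin))
      ... | no ¬d | _ = cover-∅ λ { z (refl , d , _) → ¬d (type d) }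
      ... | yes _ | no ¬b = cover-∅ λ { z (refl , _ , b) → ¬b (btw⇒Θ P x y z b) }

    cover-parts : ∀ {p P} → (∀ a l r → η (node a l r) ≡ p →
                    Basic (η l) (cL a (dg (η r)) P) × Basic (η r) (cR a (dg (η l)) P)) →
                  Lin (_∈H is p) P → Cover P (ω (suc k)) (_∈H is p)
    cover-parts {p} {P} parts lin = cover-⊆ (λ t h → cong leafΘ (is⇒ {t = t} h))
      (cover-step leaf leaf (leafΘ p) P (lin-⊆ (λ e → is⇐ (cong tyη e)) lin)
        (λ a l r e → cover-basic l refl (proj₁ (parts a l r (cong tyη e))))
        (λ a l r e → cover-basic r refl (proj₂ (parts a l r (cong tyη e)))))

    cover-classes : ∀ {p P} → (∀ t t′ → t ∈H is p → t′ ∈H is p → ∃ λ rs → ∀ w → w ∈H is p → t ≤[ P ] w → w ≤[ P ] t′ →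
                      Any (λ r → r ∈H is p × E (is p) P w r) rs) →
                    Lin (_∈H is p) P → Cover P (ω (suc (suc k))) (_∈H is p)
    cover-classes {p} {P} classes lin = cover-piece (piece (below-ω _) (rel (reg-is p)) thin-p) λ z → ∈⇐ (reg-is p)
      where
      open Lin lin
      Class : Tr → Tr → Set
      Class r w = (w ∈H is p × E (is p) P r w)
      reg-class : ∀ r → RegSet (Class r)
      reg-class r = reg-× (reg-is p) (reg-iff (λ { (w ∷ []) → id }) (λ { (w ∷ []) → id }) (reg-sec r (E-regular (is p) P)))
      -- Each interval of the class is cut at its representative r, since `E` need not be transitive
      -- before G is saturated. Both halves have pieces of rank below ω^(k+1), so the class has rank
      -- ω^(k+1).
      thin-class : ∀ {r} → r ∈H is p → Thin P (0 ∷ ω (suc k)) (rel (reg-class r))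
      thin-class {r} r∈ = covered λ t∈ t′∈ →
        let (t∈p , e) = ∈⇒ (reg-class r) t∈ ; (t′∈p , e′) = ∈⇒ (reg-class r) t′∈
            (ps , h) = cover-lift (cover-⊎ (cover-E (E-sym e) lin) (cover-E e′ lin))
        in ps , λ z z∈ p q → let (z∈p , _) = ∈⇒ (reg-class r) z∈ in h z (case ≤-total z∈p r∈ of λ where
             (inj₁ z≤r) → inj₁ (z∈p , inj₁ (p , z≤r))
             (inj₂ r≤z) → inj₂ (z∈p , inj₁ (r≤z , q)))
      -- The rank is ω^(k+1)·2: an interval is covered by finitely many classes, each of rank
      -- ω^(k+1)·1, and 2 is the next coefficient. It is still below ω^(k+2).
      thin-p : Thin P (0 ∷ 2 ∷ zeros (suc k)) (rel (reg-is p))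
      thin-p = covered λ {t} {t′} t∈ t′∈ →
        let (rs , h) = classes t t′ (∈⇒ (reg-is p) t∈) (∈⇒ (reg-is p) t′∈)
            (ps , g) = cover-Any rs by
        in ps , λ z z∈ p q → g z (Any.map (λ (r∈ , e) → r∈ , ∈⇒ (reg-is _) z∈ , E-sym e) (h z (∈⇒ (reg-is _) z∈) p q))
        where
        by : ∀ r → Cover P (0 ∷ 2 ∷ zeros (suc k)) (λ z → r ∈H is p × Class r z)
        by r with T? (is p (η r))
        ... | yes r∈ = cover-piece (piece (tl (hd (s≤s (s≤s z≤n)))) (rel (reg-class r)) (thin-class (inH r∈))) λ z (_ , c) → ∈⇐ (reg-class r) c
        ... | no ¬r∈ = cover-∅ λ z (r∈ , _) → ¬r∈ (type r∈)

-- Pumping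

module Closure (s : ℕ) (M : TreeAutomaton (Maybe (Fin s) × Maybe (Fin s))) where

  open Engine s
  open Types s M
  open Covers s M
  open Soundness s M

  sz : Tr → ℕ
  sz leaf         = 0
  sz (node _ l r) = suc (sz l + sz r)

  sz-plug : ∀ K {u v} → sz u < sz v → sz (plug K u) < sz (plug K v)
  sz-plug hole        p = p
  sz-plug (inl a K r) p = s≤s (ℕₚ.+-monoˡ-< (sz r) (sz-plug K p))
  sz-plug (inr a l K) p = s≤s (ℕₚ.+-monoʳ-< (sz l) (sz-plug K p))

  nodes : List Tr → List Tr → List Tr
  nodes ls rs = leaf ∷ List.concatMap (λ a → List.cartesianProductWith (node a) ls rs) (List.allFin s)

  ∈-nodes : ∀ {ls rs a l r} → l ∈ ls → r ∈ rs → node a l r ∈ nodes ls rs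
  ∈-nodes {ls} {rs} {a} p q = there (∈-concatMap⁺ (λ a → List.cartesianProductWith (node a) ls rs)
                                (lose (∈-allFin a) (∈-cartesianProductWith⁺ (node a) p q)))

  trees : ℕ → List Tr
  trees zero    = leaf ∷ []
  trees (suc h) = nodes (trees h) (trees h)

  ∈-trees : ∀ h t → ht t ≤ h → t ∈ trees h
  ∈-trees zero    leaf         _       = here refl
  ∈-trees (suc h) leaf         _       = here refl
  ∈-trees (suc h) (node a l r) (s≤s p) = ∈-nodes (∈-trees h l (ℕₚ.≤-trans (ℕₚ.m≤m⊔n _ _) p))
                                                 (∈-trees h r (ℕₚ.≤-trans (ℕₚ.m≤n⊔m (ht l) _) p))

  reg-list : ∀ ts → RegSet (_∈ ts)
  reg-list []       = reg-iff (λ { (_ ∷ []) () }) (λ { (_ ∷ []) () }) (reg-alg {P = λ _ → ⊥} finH ηA (λ _ → no λ ()))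
  reg-list (t ∷ ts) = reg-iff (λ { (_ ∷ []) (inj₁ p) → here p ; (_ ∷ []) (inj₂ p) → there p })
                              (λ { (_ ∷ []) (here p) → inj₁ p ; (_ ∷ []) (there p) → inj₂ p })
                              (reg-⊎ (reg-single t) (reg-list ts))

  module Short (h : ℕ) where

    private
      W : RSet
      W = rel (reg-list (trees h))

    -- w extends at most h levels beyond the domains of t and t′.
    short : Tr → Tr → Tr → Bool
    short t t′ leaf           = true
    short t t′ w@(node _ l r) = if isLeaf (rt t) ∧ isLeaf (rt t′) then holds W (w ∷ [])
                                else short (lf t) (lf t′) l ∧ short (rg t) (rg t′) r

    enum : Tr → Tr → List Tr
    enum leaf leaf                       = leaf ∷ trees h
    enum leaf (node _ t₀ t₁)             = nodes (enum leaf t₀) (enum leaf t₁)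
    enum (node _ t₀ t₁) leaf             = nodes (enum t₀ leaf) (enum t₁ leaf)
    enum (node _ t₀ t₁) (node _ t₀′ t₁′) = nodes (enum t₀ t₀′) (enum t₁ t₁′)

    ∈-enum : ∀ t t′ w → T (short t t′ w) → w ∈ enum t t′
    ∈-enum leaf leaf leaf _ = here refl
    ∈-enum leaf (node _ _ _) leaf _ = here refl
    ∈-enum (node _ _ _) leaf leaf _ = here refl
    ∈-enum (node _ _ _) (node _ _ _) leaf _ = here refl
    ∈-enum leaf leaf (node _ _ _) p = there (∈⇒ (reg-list (trees h)) (mem p))
    ∈-enum leaf (node _ t₀ t₁) (node _ l r) p =
      let (q , q′) = Equivalence.to T-∧ p in ∈-nodes (∈-enum leaf t₀ l q) (∈-enum leaf t₁ r q′)
    ∈-enum (node _ t₀ t₁) leaf (node _ l r) p =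
      let (q , q′) = Equivalence.to T-∧ p in ∈-nodes (∈-enum t₀ leaf l q) (∈-enum t₁ leaf r q′)
    ∈-enum (node _ t₀ t₁) (node _ t₀′ t₁′) (node _ l r) p =
      let (q , q′) = Equivalence.to T-∧ p in ∈-nodes (∈-enum t₀ t₀′ l q) (∈-enum t₁ t₁′ r q′)

    Deep : Tr → Tr → Tr → Set
    Deep t t′ w = ∃₂ λ K u → w ≡ plug K u × Out K t × Out K t′ × h < ht u

    long-step : ∀ t t′ a l r → (¬ T (short (lf t) (lf t′) l) → Deep (lf t) (lf t′) l) →
                (¬ T (short (rg t) (rg t′) r) → Deep (rg t) (rg t′) r) →
                ¬ T (short (lf t) (lf t′) l ∧ short (rg t) (rg t′) r) → Deep t t′ (node a l r)
    long-step t t′ a l r f g ¬p with T? (short (lf t) (lf t′) l) | T? (short (rg t) (rg t′) r)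
    ... | yes p | yes q = contradiction (Equivalence.from T-∧ (p , q)) ¬p
    ... | no ¬q | _ = let (K , u , e , o , o′ , lt) = f ¬q in inl a K r , u , cong (λ l → node a l r) e , o , o′ , lt
    ... | yes _ | no ¬q = let (K , u , e , o , o′ , lt) = g ¬q in inr a l K , u , cong (node a l) e , o , o′ , lt

    long : ∀ t t′ w → ¬ T (short t t′ w) → Deep t t′ w
    long t t′ leaf ¬p = contradiction tt ¬p
    long leaf leaf w@(node _ _ _) ¬p with ht w ℕₚ.≤? h
    ... | yes q = contradiction (accepted (∈⇐ (reg-list (trees h)) (∈-trees h w q))) ¬p
    ... | no ¬q = hole , w , refl , refl , refl , ℕₚ.≰⇒> ¬q
    long t@leaf t′@(node _ _ _) (node a l r) ¬p = long-step t t′ a l r (long _ _ l) (long _ _ r) ¬p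
    long t@(node _ _ _) t′@leaf (node a l r) ¬p = long-step t t′ a l r (long _ _ l) (long _ _ r) ¬p
    long t@(node _ _ _) t′@(node _ _ _) (node a l r) ¬p = long-step t t′ a l r (long _ _ l) (long _ _ r) ¬p

    shortA : Alg 3 (Fin (Rel.size W) × Bool)
    shortA = record
      { φ   = λ { (t ∷ t′ ∷ w ∷ []) → φ (alg W) (w ∷ []) , short t t′ w }
      ; δ   = λ { (a ∷ b ∷ nothing ∷ []) (p , _) (q , _) → Alg.δ (alg W) (nothing ∷ []) p q , true
                ; (a ∷ b ∷ just c ∷ []) (p , x) (q , y) → let w = Alg.δ (alg W) (just c ∷ []) p q in
                    w , (if isLeaf a ∧ isLeaf b then Rel.out W w else x ∧ y) }
      ; hom = λ { (t ∷ t′ ∷ leaf ∷ []) → cong (_, true) (hom (alg W) _)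
                ; (t ∷ t′ ∷ node c l r ∷ []) → cong
                    (λ p → p , (if isLeaf (rt t) ∧ isLeaf (rt t′) then Rel.out W p else short (lf t) (lf t′) l ∧ short (rg t) (rg t′) r))
                    (hom (alg W) (node c l r ∷ [])) } }

    reg-short : Reg (on₃ λ t t′ w → T (short t t′ w))
    reg-short = reg-iff (λ { (_ ∷ _ ∷ _ ∷ []) → id }) (λ { (_ ∷ _ ∷ _ ∷ []) → id })
      (reg-alg {P = λ (_ , b) → T b} (fin× finFin finBool) shortA (λ _ → T? _))

  -- The i-th node on a longest path of u, with the context around it.
  at : Tr → ℕ → Ctx × Tr
  at u            zero    = hole , u
  at leaf         (suc i) = hole , leaf
  at (node a l r) (suc i) with ht r ℕₚ.≤? ht l
  ... | yes _ = let (C , u) = at l i in inl a C r , u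
  ... | no  _ = let (C , u) = at r i in inr a l C , u

  at-plug : ∀ u i → u ≡ plug (proj₁ (at u i)) (proj₂ (at u i))
  at-plug u            zero    = refl
  at-plug leaf         (suc i) = refl
  at-plug (node a l r) (suc i) with ht r ℕₚ.≤? ht l
  ... | yes _ = cong (λ l → node a l r) (at-plug l i)
  ... | no  _ = cong (node a l) (at-plug r i)

  at-leaf : ∀ d → at leaf d ≡ (hole , leaf)
  at-leaf zero    = refl
  at-leaf (suc d) = refl

  at-+ : ∀ u i d → at u (i + d) ≡ (let (C , v) = at u i ; (L , v′) = at v d in C ∙ L , v′)
  at-+ u            zero    d = refl
  at-+ leaf         (suc i) d = sym (cong (λ (L , v) → L , v) (at-leaf d))
  at-+ (node a l r) (suc i) d with ht r ℕₚ.≤? ht l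
  ... | yes _ = cong (λ (C , u) → inl a C r , u) (at-+ l i d)
  ... | no  _ = cong (λ (C , u) → inr a l C , u) (at-+ r i d)

  at-ht : ∀ u i → i < ht u → 0 < ht (proj₂ (at u i))
  at-ht u            zero    p = p
  at-ht (node a l r) (suc i) (s≤s p) with ht r ℕₚ.≤? ht l
  ... | yes q = at-ht l i (subst (i <_) (ℕₚ.m≥n⇒m⊔n≡m q) p)
  ... | no ¬q = at-ht r i (subst (i <_) (ℕₚ.m≤n⇒m⊔n≡n (ℕₚ.<⇒≤ (ℕₚ.≰⇒> ¬q))) p)

  at-sz : ∀ u d → sz (proj₂ (at u d)) ≤ sz u
  at-sz u            zero    = ℕₚ.≤-refl
  at-sz leaf         (suc d) = z≤n
  at-sz (node a l r) (suc d) with ht r ℕₚ.≤? ht l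
  ... | yes _ = ℕₚ.m≤n⇒m≤1+n (ℕₚ.≤-trans (at-sz l d) (ℕₚ.m≤m+n _ _))
  ... | no  _ = ℕₚ.m≤n⇒m≤1+n (ℕₚ.≤-trans (at-sz r d) (ℕₚ.m≤n+m _ (sz l)))

  at-sz< : ∀ u d → 0 < ht u → sz (proj₂ (at u (suc d))) < sz u
  at-sz< (node a l r) d _ with ht r ℕₚ.≤? ht l
  ... | yes _ = s≤s (ℕₚ.≤-trans (at-sz l d) (ℕₚ.m≤m+n _ _))
  ... | no  _ = s≤s (ℕₚ.≤-trans (at-sz r d) (ℕₚ.m≤n+m _ (sz l)))

  -- The context is read on both tapes at once, so its effect on a pair of plugged trees is a
  -- function on states. There are finitely many such functions, which makes `code` finite.
  act : ∀ {C} → Alg 2 C → Ctx → C → C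
  act A hole        c = c
  act A (inl a K r) c = Alg.δ A (just a ∷ just a ∷ []) (act A K c) (φ A (r ∷ r ∷ []))
  act A (inr a l K) c = Alg.δ A (just a ∷ just a ∷ []) (φ A (l ∷ l ∷ [])) (act A K c)

  act-plug : ∀ {C} (A : Alg 2 C) K u v → φ A (plug K u ∷ plug K v ∷ []) ≡ act A K (φ A (u ∷ v ∷ []))
  act-plug A hole        u v = refl
  act-plug A (inl a K r) u v = trans (hom A _) (cong (λ c → Alg.δ A _ c _) (act-plug A K u v))
  act-plug A (inr a l K) u v = trans (hom A _) (cong (Alg.δ A _ _) (act-plug A K u v))

  act-∙ : ∀ {C} (A : Alg 2 C) K L c → act A (K ∙ L) c ≡ act A K (act A L c)
  act-∙ A hole        L c = refl
  act-∙ A (inl a K r) L c = cong (λ c → Alg.δ A _ c _) (act-∙ A K L c)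
  act-∙ A (inr a l K) L c = cong (Alg.δ A _ _) (act-∙ A K L c)

  module Pump {C : Set} (F : Finite C) (A : Alg 2 C) where

    Code : Set
    Code = Vec C (Finite.size F) × H

    finCode : Finite Code
    finCode = fin× (finVec F _) finH

    code : Ctx → Tr → Code
    code K u = tabulate (act A K ∘ dec F) , η u

    bound : ℕ
    bound = Finite.size finCode

    -- `same` says that L is absorbed by K, not that L acts as the identity or idempotently: this is
    -- exactly what a single repetition of `code` along a path provides.
    record Pumpable (t t′ w : Tr) : Set where
      field
        K L     : Ctx
        u       : Tr
        split   : w ≡ plug K (plug L u)
        out     : Out K t
        out′    : Out K t′
        same    : ∀ c → act A K (act A L c) ≡ act A K c
        same-η  : η (plug L u) ≡ η u
        shorter : sz u < sz (plug L u)

      v : ℕ → Tr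
      v zero    = u
      v (suc m) = plug L (v m)

      v-η : ∀ m → η (v m) ≡ η u
      v-η zero    = refl
      v-η (suc m) = trans (η-plug L (v m) u (v-η m)) same-η

      seq : ℕ → Tr
      seq m = plug K (v m)

      -- `same` absorbs the copies of L into K one by one. So every property of neighbours that A
      -- can see holds all along the sequence or nowhere in it.
      seq-code : ∀ m → φ A (seq m ∷ seq (suc m) ∷ []) ≡ φ A (seq 0 ∷ seq 1 ∷ [])
      seq-code m = trans (act-plug A K (v m) (v (suc m))) (trans (go m) (sym (act-plug A K u (plug L u))))
        where
        go : ∀ m → act A K (φ A (v m ∷ v (suc m) ∷ [])) ≡ act A K (φ A (u ∷ plug L u ∷ []))
        go zero    = refl
        go (suc m) = trans (cong (act A K) (act-plug A L (v m) (v (suc m)))) (trans (same _) (go m))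

    pump : ∀ {t t′ w} → Short.Deep bound t t′ w → Pumpable t t′ w
    pump {t} {t′} {w} (K₀ , u₀ , e , o , o′ , lt)
      -- The height of u₀ exceeds `bound`, so its longest path has at least `bound` + 1 inner nodes
      -- and two of them share a code. The code is that of the whole context from the root of w,
      -- including K₀.
      with pigeonhole ℕₚ.≤-refl (λ (i : Fin (suc bound)) → let (C′ , u) = at u₀ (toℕ i) in enc finCode (code (K₀ ∙ C′) u))
    ... | i , j , i<j , eq with ℕₚ.m≤n⇒∃[o]m+o≡n i<j
    ...   | d , i+d≡j = record
      { K = K₀ ∙ Cᵢ ; L = L ; u = u₁ ; split = trans e (trans (cong (plug K₀) (trans (at-plug u₀ (toℕ i)) (cong (plug Cᵢ) (at-plug uᵢ (suc d))))) (sym (plug-∙ K₀ Cᵢ _)))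
      ; out = out-∙ K₀ Cᵢ t o ; out′ = out-∙ K₀ Cᵢ t′ o′
      ; same = λ c → trans (sym (act-∙ A (K₀ ∙ Cᵢ) L c)) (trans (cong (λ K → act A K c) (trans (∙-assoc K₀ Cᵢ L) (cong (K₀ ∙_) (sym C-split)))) (sym (acts c)))
      ; same-η = trans (cong η (sym (at-plug uᵢ (suc d)))) (trans (cong proj₂ codes) (cong η u-split))
      ; shorter = subst (λ v → sz u₁ < sz v) (at-plug uᵢ (suc d)) (at-sz< uᵢ d (at-ht u₀ (toℕ i) (ℕₚ.≤-trans (Finₚ.toℕ<n i) lt))) }
      where
      Cᵢ = proj₁ (at u₀ (toℕ i))
      uᵢ = proj₂ (at u₀ (toℕ i))
      L = proj₁ (at uᵢ (suc d))
      u₁ = proj₂ (at uᵢ (suc d))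
      both : at u₀ (toℕ j) ≡ (Cᵢ ∙ L , u₁)
      both = trans (cong (at u₀) (trans (sym i+d≡j) (sym (ℕₚ.+-suc (toℕ i) d)))) (at-+ u₀ (toℕ i) (suc d))
      C-split : proj₁ (at u₀ (toℕ j)) ≡ Cᵢ ∙ L
      C-split = cong proj₁ both
      u-split : proj₂ (at u₀ (toℕ j)) ≡ u₁
      u-split = cong proj₂ both
      codes : code (K₀ ∙ Cᵢ) uᵢ ≡ code (K₀ ∙ proj₁ (at u₀ (toℕ j))) (proj₂ (at u₀ (toℕ j)))
      codes = trans (sym (dec-enc finCode _)) (trans (cong (dec finCode) eq) (dec-enc finCode _))
      acts : ∀ c → act A (K₀ ∙ Cᵢ) c ≡ act A (K₀ ∙ proj₁ (at u₀ (toℕ j))) c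
      acts c = trans (sym (val (K₀ ∙ Cᵢ))) (trans (cong (λ p → lookup (proj₁ p) (enc F c)) codes) (val (K₀ ∙ proj₁ (at u₀ (toℕ j)))))
        where
        val : ∀ K → lookup (tabulate (act A K ∘ dec F)) (enc F c) ≡ act A K c
        val K = trans (lookup∘tabulate _ (enc F c)) (cong (act A K) (dec-enc F c))

-- The least closed set of basics

module Fixpoint (s : ℕ) (M : TreeAutomaton (Maybe (Fin s) × Maybe (Fin s))) where

  open Engine s
  open Types s M
  open Covers s M
  open Soundness s M
  open Closure s M

  reg-≤ : ∀ P → Reg (on₂ (λ u v → u ≤[ P ] v))
  reg-≤ P = reg-iff (λ { (_ ∷ _ ∷ []) → le }) (λ { (_ ∷ _ ∷ []) → eval })
    (reg-alg {P = T ∘ lookup P} finFin τA (λ _ → T? _))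

  module Rules (G : H → Pr → Bool) where

    open Good G

    Parts : H → Pr → Set
    Parts p P = ∀ a l r → η (node a l r) ≡ p →
                  Basic (η l) (cL a (dg (η r)) P) × Basic (η r) (cR a (dg (η l)) P)

    parts? : ∀ p P → Dec (Parts p P)
    parts? p P = map′ (λ f a l r → f a r l) (λ f a r l → f a l r)
                      (Finite.decAll finFin λ a → decide (reg-∀ (reg-∀ (reg-part a))) [])
      where
      A : Alg 2 (H × H)
      A = reA (i0 ∷ []) ηA ⊗ reA (i1 ∷ []) ηA
      reg-part : ∀ a → Reg (on₂ λ l r → η (node a l r) ≡ p →
                   Basic (η l) (cL a (dg (η r)) P) × Basic (η r) (cR a (dg (η l)) P))
      reg-part a = reg-iff (λ { (_ ∷ _ ∷ []) → id }) (λ { (_ ∷ _ ∷ []) → id })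
        (reg-alg {P = λ (h , h′) → Alg.δ ηA (just a ∷ []) h h′ ≡ p →
                    Basic h (cL a (dg h′) P) × Basic h′ (cR a (dg h) P)} (fin× finH finH) A
          (λ _ → Finite._≟_ finH _ p →-dec (T? _ ×-dec T? _)))

    module _ (p : H) (P : Pr) where

      E-rel : Rel 2
      E-rel = rel (E-regular (is p) P)

      -- Order and `E` run together, so that one pumped sequence is uniform for both: monotone, and
      -- with all neighbours equivalent or none.
      pairA : Alg 2 (Q × Fin (Rel.size E-rel))
      pairA = τA ⊗ alg E-rel

      finPair : Finite (Q × Fin (Rel.size E-rel))
      finPair = fin× finFin finFin

      open Pump finPair pairA
      open Short bound

      -- The decidable form of finiteness: only finitely many trees are short for given t and t′
      -- (`enum`), so the classes met between them are finitely many. The representative r may lie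
      -- outside the interval, for only its class counts. Quantifiers prepend, so the predicate
      -- under them is about the vector t, t′, w.
      Canon : Set
      Canon = ∀ w t′ t → (t ∈H is p × t′ ∈H is p × w ∈H is p × t ≤[ P ] w × w ≤[ P ] t′) →
                ∃ λ r → r ∈H is p × T (short t t′ r) × E (is p) P w r

      canon? : Dec Canon
      canon? = decide (reg-∀ (reg-∀ (reg-∀ (reg-→
          (reg-× (reg-re (i0 ∷ []) (reg-is p)) (reg-× (reg-re (i1 ∷ []) (reg-is p)) (reg-× (reg-re (i2 ∷ []) (reg-is p))
             (reg-× (reg-re (i0 ∷ i2 ∷ []) (reg-≤ P)) (reg-re (i2 ∷ i1 ∷ []) (reg-≤ P))))))
          (reg-∃ (reg-× (reg-re (i0 ∷ []) (reg-is p)) (reg-× (reg-re (i1 ∷ i2 ∷ i0 ∷ []) reg-short)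
             (reg-re (i3 ∷ i0 ∷ []) (E-regular (is p) P)))))))) ) []

    module _ (sat : Saturated) where

      open Sat sat

      -- A finite cover of an interval by classes of E makes every fibre in that interval canonical:
      -- a tree that is too deep is pumped, and pumping yields a monotone sequence that would
      -- meet infinitely many classes unless removing the pumped part stays in the same class.
      module Interval {D : H → Bool} {P : Pr} (lin : Lin (_∈H D) P) {x y : Tr} (x∈ : x ∈H D) (y∈ : y ∈H D)
                      (zs : List Tr) (cover : ∀ z → z ∈H D → Btw P x y z → Any (λ r → r ∈H D × E D P z r) zs)
                      (K₀ : Ctx) (u₀ : Tr) (ox : Out K₀ x) (oy : Out K₀ y) (d₀ : plug K₀ u₀ ∈H D)
                      (b₀ : Btw P x y (plug K₀ u₀)) where

        p : H
        p = η u₀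

        P′ : Pr
        P′ = cm K₀ P

        open Lin lin

        inD : ∀ {t} → t ∈H is p → plug K₀ t ∈H D
        inD {t} t∈ = ∈H-plug {D} {P} K₀ {u₀} {t} (sym (is⇒ t∈)) d₀

        lin′ : Lin (_∈H is p) P′
        lin′ = lin-plug K₀ inD lin

        open Pump (finPair p P′) (pairA p P′)
        open Short bound

        fibre-E : ∀ {u v} → E D P (plug K₀ u) (plug K₀ v) → E (is p) P′ u v
        fibre-E = E-unplug K₀ inD

        module _ {t t′ w} (t∈ : t ∈H is p) (t′∈ : t′ ∈H is p) (w∈ : w ∈H is p) (pm : Pumpable t t′ w) where
          open Pumpable pm renaming (out to o; out′ to o′)

          seq-η : ∀ m → η (seq m) ≡ p
          seq-η m = trans (η-plug K (v m) (plug L u) (trans (v-η m) (sym same-η))) (trans (cong η (sym split)) (is⇒ w∈))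

          seq∈ : ∀ m → seq m ∈H is p
          seq∈ m = is⇐ (seq-η m)

          seq-≤ : ∀ m → seq 0 ≤[ P′ ] seq 1 → seq m ≤[ P′ ] seq (suc m)
          seq-≤ m (le h) = le (subst (T ∘ lookup P′) (sym (cong proj₁ (seq-code m))) h)

          seq-≥ : ∀ m → ¬ seq 0 ≤[ P′ ] seq 1 → seq (suc m) ≤[ P′ ] seq m
          seq-≥ m n = case Lin.≤-total lin′ (seq∈ (suc m)) (seq∈ m) of λ where
            (inj₁ h)      → h
            (inj₂ (le h)) → contradiction (le (subst (T ∘ lookup P′) (cong proj₁ (seq-code m)) h)) n

          seq-E : ∀ m → E (is p) P′ (seq m) (seq (suc m)) → E (is p) P′ (seq 0) (seq 1)
          seq-E m e = sound R (seq 0 ∷ seq 1 ∷ [])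
            (subst (T ∘ Rel.out (rel R)) (cong proj₂ (seq-code m)) (complete R (seq m ∷ seq (suc m) ∷ []) e))
            where R = E-regular (is p) P′

          z : ℕ → Tr
          z m = plug K₀ (seq m)

          z∈ : ∀ m → z m ∈H D
          z∈ m = inD (seq∈ m)

          class : ∀ m → Any (λ r → r ∈H D × E D P (z m) r) zs
          class m = cover (z m) (z∈ m) (Btw-plug {D} {P} K₀ {x} {y} {u₀} {seq m} ox oy (sym (seq-η m)) b₀)

          module _ (i : ℕ) where

            up : seq 0 ≤[ P′ ] seq 1 → ∀ m → z m ≤[ P ] z (suc m)
            up h m = ≤-plug K₀ P (seq-≤ m h)

            ups : seq 0 ≤[ P′ ] seq 1 → ∀ d → z (suc i) ≤[ P ] z (suc (i + d))
            ups h zero    = subst (λ j → z (suc i) ≤[ P ] z (suc j)) (sym (ℕₚ.+-identityʳ i)) (≤-refl (z∈ (suc i)))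
            ups h (suc d) = subst (λ j → z (suc i) ≤[ P ] z (suc j)) (sym (ℕₚ.+-suc i d))
              (≤-trans (z∈ (suc i)) (z∈ (suc (i + d))) (z∈ (suc (suc (i + d)))) (ups h d) (up h (suc (i + d))))

            down : ¬ seq 0 ≤[ P′ ] seq 1 → ∀ m → z (suc m) ≤[ P ] z m
            down n m = ≤-plug K₀ P (seq-≥ m n)

            downs : ¬ seq 0 ≤[ P′ ] seq 1 → ∀ d → z (suc (i + d)) ≤[ P ] z (suc i)
            downs n zero    = subst (λ j → z (suc j) ≤[ P ] z (suc i)) (sym (ℕₚ.+-identityʳ i)) (≤-refl (z∈ (suc i)))
            downs n (suc d) = subst (λ j → z (suc j) ≤[ P ] z (suc i)) (sym (ℕₚ.+-suc i d))
              (≤-trans (z∈ (suc (suc (i + d)))) (z∈ (suc (i + d))) (z∈ (suc i)) (down n (suc (i + d))) (downs n d))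

            between : ∀ d → Btw P (z i) (z (suc (i + d))) (z (suc i))
            between d = case seq 0 ≤[ P′ ]? seq 1 of λ where
              (yes h) → inj₁ (up h i , ups h d)
              (no n)  → inj₂ (downs n d , down n i)

          Same : ℕ → ℕ → Set
          Same i j = ∃ λ r → r ∈H D × E D P (z i) r × E D P (z j) r

          same-class : ∀ i j → index (class i) ≡ index (class j) → Same i j
          same-class i j eq = List.lookup zs (index (class i)) , proj₁ (lookup-index (class i)) , proj₂ (lookup-index (class i)) ,
            subst (λ k → E D P (z j) (List.lookup zs k)) (sym eq) (proj₂ (lookup-index (class j)))

          -- The sequence is monotone, so its term after i lies between the two terms that share a
          -- class. Convexity makes the neighbours equivalent, and `seq-E` carries this back to the
          -- start of the sequence.
          collide : ∀ i d → Same i (suc (i + d)) → E (is p) P′ (seq 0) (seq 1)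
          collide i d (r , r∈ , e , e′) = seq-E i (fibre-E (E-convex lin (z∈ i) (z∈ (suc i)) (z∈ (suc (i + d)))
            (E-trans lin (z∈ i) r∈ (z∈ (suc (i + d))) e (E-sym e′)) (between i d)))

          collision : ∃₂ λ i d → Same i (suc (i + d))
          collision =
            let (i , j , i<j , eq) = pigeonhole ℕₚ.≤-refl (λ (i : Fin (suc (length zs))) → index (class (toℕ i)))
                (d , i+d≡j) = ℕₚ.m≤n⇒∃[o]m+o≡n i<j
            in toℕ i , d , subst (Same (toℕ i)) (sym i+d≡j) (same-class (toℕ i) (toℕ j) eq)

          shortened : E (is p) P′ (seq 0) (seq 1)
          shortened = let (i , d , same) = collision in collide i d same

          w₀ : Tr
          w₀ = seq 0

          w≡ : w ≡ seq 1
          w≡ = split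

          w₀-ty : ty t t′ w₀ ≡ ty t t′ w
          w₀-ty = trans (ty-plug K t t′ u (plug L u) o o′ (sym same-η)) (cong (ty t t′) (sym split))

          w₀-short : sz w₀ < sz w
          w₀-short = subst (λ v → sz w₀ < sz v) (sym split) (sz-plug K shorter)

        Rep : Tr → Tr → Tr → Set
        Rep t t′ w = ∃ λ r → r ∈H is p × T (short t t′ r) × E (is p) P′ w r

        From : Tr → Tr → Tr → Set
        From t t′ w = w ∈H is p × t ≤[ P′ ] w × w ≤[ P′ ] t′

        module _ {t t′ w} (t∈ : t ∈H is p) (t′∈ : t′ ∈H is p) (w∈ : w ∈H is p) (pm : Pumpable t t′ w) where

          w₀-from : t ≤[ P′ ] w → w ≤[ P′ ] t′ → From t t′ (w₀ t∈ t′∈ w∈ pm)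
          w₀-from t≤ ≤t′ = seq∈ t∈ t′∈ w∈ pm 0 ,
            le (subst (T ∘ lookup P′) (sym (cong proj₁ (w₀-ty t∈ t′∈ w∈ pm))) (eval t≤)) ,
            le (subst (T ∘ lookup P′) (sym (cong (λ θ → proj₁ (proj₂ (proj₂ (proj₂ θ)))) (w₀-ty t∈ t′∈ w∈ pm))) (eval ≤t′))

          E-w₀ : E (is p) P′ (w₀ t∈ t′∈ w∈ pm) w
          E-w₀ = subst (E (is p) P′ (w₀ t∈ t′∈ w∈ pm)) (sym (w≡ t∈ t′∈ w∈ pm)) (shortened t∈ t′∈ w∈ pm)

          rep-w₀ : Rep t t′ (w₀ t∈ t′∈ w∈ pm) → Rep t t′ w
          rep-w₀ (r , r∈ , sh , e) = r , r∈ , sh , E-trans lin′ w∈ (seq∈ t∈ t′∈ w∈ pm 0) r∈ (E-sym E-w₀) e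

        -- Induction on size. A tree that is too deep is replaced by `seq 0`, where the pumped part
        -- is cut out: `w₀-ty` keeps it between t and t′, and `shortened` keeps it in the class of
        -- w.
        rep : ∀ {w} → Acc _<_ (sz w) → ∀ {t t′} → t ∈H is p → t′ ∈H is p → From t t′ w → Rep t t′ w
        rep′ : ∀ {w} → Acc _<_ (sz w) → ∀ {t t′} → t ∈H is p → t′ ∈H is p → From t t′ w → Dec (T (short t t′ w)) → Rep t t′ w
        rep a t∈ t′∈ f = rep′ a t∈ t′∈ f (T? _)
        rep′ a t∈ t′∈ (w∈ , _ , _) (yes sh) = _ , w∈ , sh , E-refl lin′ w∈
        rep′ {w} (acc rs) {t} {t′} t∈ t′∈ (w∈ , t≤ , ≤t′) (no ¬sh) =
          rep-w₀ t∈ t′∈ w∈ pm (rep (rs (w₀-short t∈ t′∈ w∈ pm)) t∈ t′∈ (w₀-from t∈ t′∈ w∈ pm t≤ ≤t′))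
          where
          pm : Pumpable t t′ w
          pm = pump (long t t′ w ¬sh)

        canon : Canon p P′
        canon w t′ t (t∈ , t′∈ , f) = rep (<-wellFounded _) t∈ t′∈ f

      E-step : (∀ p P → Canon p P → Basic p P) → ∀ {D P} → Lin (_∈H D) P → ∀ {x y} → x ∈H D → y ∈H D → ∀ zs →
               (∀ z → z ∈H D → Btw P x y z → Any (λ r → r ∈H D × E D P z r) zs) → E D P x y
      E-step closed lin x∈ y∈ zs cover = E-intro λ K u ox oy d b →
        closed (η u) (cm K _) (Interval.canon lin x∈ y∈ zs cover K u ox oy d b)

  N : ℕ
  N = Finite.size finB

  ⟦_⟧ : Subset N → H → Pr → Bool
  ⟦ S ⟧ p P = lookup S (enc finB (p , P))

  Fires : Subset N → H × Pr → Set
  Fires S (p , P) = T (⟦ S ⟧ p P) ⊎ Rules.Parts ⟦ S ⟧ p P ⊎ Rules.Canon ⟦ S ⟧ p P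

  fires? : ∀ S B → Dec (Fires S B)
  fires? S (p , P) = T? _ ⊎-dec (Rules.parts? ⟦ S ⟧ p P ⊎-dec Rules.canon? ⟦ S ⟧ p P)

  -- `Finite` does not say that `enc` is onto, so i may differ from the code of what it decodes to.
  -- Keeping the old indices explicitly makes `grow` inflationary at every index.
  New : Subset N → Fin N → Set
  New S i = T (lookup S i) ⊎ Fires S (dec finB i)

  new? : ∀ S i → Dec (New S i)
  new? S i = T? _ ⊎-dec fires? S (dec finB i)

  abstract
    grow : Subset N → Subset N
    grow S = tabulate λ i → does (new? S i)

    grow⇒ : ∀ S i → T (lookup (grow S) i) → New S i
    grow⇒ S i h = of-does (new? S i) (subst T (lookup∘tabulate _ i) h)

    grow⇐ : ∀ S i → New S i → T (lookup (grow S) i)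
    grow⇐ S i h = subst T (sym (lookup∘tabulate _ i)) (to-does (new? S i) h)

  sound-fires : ∀ {k} S → SoundAt k ⟦ S ⟧ → ∀ p P → Fires S (p , P) → Lin (_∈H is p) P → Cover P (ω (suc (suc k))) (_∈H is p)
  sound-fires S sound p P (inj₁ old)          lin = cover-raise (sound old lin)
  sound-fires S sound p P (inj₂ (inj₁ parts)) lin = cover-raise (Use.cover-parts ⟦ S ⟧ sound parts lin)
  sound-fires S sound p P (inj₂ (inj₂ canon)) lin = Use.cover-classes ⟦ S ⟧ sound
    (λ t t′ t∈ t′∈ → enum t t′ , λ w w∈ p q →
       let (r , r∈ , sh , e) = canon w t′ t (t∈ , t′∈ , w∈ , p , q) in lose (∈-enum t t′ r sh) (r∈ , e)) lin
    where
    open Pump (Rules.finPair ⟦ S ⟧ p P) (Rules.pairA ⟦ S ⟧ p P)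
    open Short bound

  sound-grow : ∀ {k} S → SoundAt k ⟦ S ⟧ → SoundAt (suc k) ⟦ grow S ⟧
  sound-grow S sound {p} {P} h = sound-fires S sound p P (new⇒fires (grow⇒ S (enc finB (p , P)) h))
    where
    new⇒fires : New S (enc finB (p , P)) → Fires S (p , P)
    new⇒fires (inj₁ old) = inj₁ old
    new⇒fires (inj₂ f)   = subst (Fires S) (dec-enc finB (p , P)) f

  Stable : Subset N → Set
  Stable S = ∀ i → New S i → T (lookup S i)

  Result : Set
  Result = ∃₂ λ k S → SoundAt k ⟦ S ⟧ × Stable S

  Gap : Subset N → Set
  Gap S = ∃ λ i → New S i × ¬ T (lookup S i)

  gap? : ∀ S → Dec (Gap S)
  gap? S = any? (λ i → new? S i ×-dec ¬? (T? (lookup S i)))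

  no-gap : ∀ S → ¬ Gap S → Stable S
  no-gap S none i new = case T? (lookup S i) of λ where
    (yes p) → p
    (no ¬p) → contradiction (i , new , ¬p) none

  gap-⊂ : ∀ S → Gap S → S ⊂ grow S
  gap-⊂ S (i , new , ¬p) =
    (λ {j} j∈ → lookup⇒[]= j _ (Equivalence.to T-≡ (grow⇐ S j (inj₁ (Equivalence.from T-≡ ([]=⇒lookup j∈)))))) ,
    i , lookup⇒[]= i _ (Equivalence.to T-≡ (grow⇐ S i new)) , λ i∈ → ¬p (Equivalence.from T-≡ ([]=⇒lookup i∈))

  -- Each gap makes the subset strictly larger, so at most N rounds occur. The counter k grows by
  -- one per round, as the exponent does in `sound-grow`; at the empty set `SoundAt 0` is vacuous.
  iterate : ∀ fuel k S → N ≤ ∣ S ∣ + fuel → SoundAt k ⟦ S ⟧ → Result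
  iterate′ : ∀ fuel k S → N ≤ ∣ S ∣ + fuel → SoundAt k ⟦ S ⟧ → Dec (Gap S) → Result
  iterate fuel k S big sound = iterate′ fuel k S big sound (gap? S)
  iterate′ fuel k S big sound (no none) = k , S , (λ {p} {P} → sound {p} {P}) , no-gap S none
  iterate′ zero k S big sound (yes gap) = contradiction (ℕₚ.≤-trans (p⊂q⇒∣p∣<∣q∣ (gap-⊂ S gap)) (∣p∣≤n (grow S)))
    (ℕₚ.≤⇒≯ (subst (N ≤_) (ℕₚ.+-identityʳ _) big))
  iterate′ (suc fuel) k S big sound (yes gap) = iterate fuel (suc k) (grow S)
    (ℕₚ.≤-trans (subst (N ≤_) (ℕₚ.+-suc _ fuel) big) (ℕₚ.+-monoˡ-≤ fuel (p⊂q⇒∣p∣<∣q∣ (gap-⊂ S gap))))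
    (λ {p} {P} → sound-grow S sound {p} {P})

  abstract
    stable : Result
    stable = iterate N 0 (replicate N false) (ℕₚ.m≤n+m N _)
      λ {p} {P} h _ → contradiction (subst T (lookup-replicate (enc finB (p , P)) false) h) id

  module AtFixpoint (S : Subset N) (st : Stable S) where

    at-code : ∀ p P → Fires S (p , P) → T (⟦ S ⟧ p P)
    at-code p P f = st (enc finB (p , P)) (inj₂ (subst (Fires S) (sym (dec-enc finB (p , P))) f))

    saturated : Good.Saturated ⟦ S ⟧
    saturated p P parts = at-code p P (inj₂ (inj₁ parts))

    canonical : ∀ p P → Rules.Canon ⟦ S ⟧ p P → T (⟦ S ⟧ p P)
    canonical p P c = at-code p P (inj₂ (inj₂ c))

infix 4 _≼_
_≼_ : ∀ {k} → Vec ℕ k → Vec ℕ k → Set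
a ≼ b = a ≺ b ⊎ a ≡ b

≺-≼-trans : ∀ {k} {a b c : Vec ℕ k} → a ≺ b → b ≼ c → a ≺ c
≺-≼-trans p (inj₁ q)    = ≺-trans p q
≺-≼-trans p (inj₂ refl) = p

≼-total : ∀ {k} (a b : Vec ℕ k) → a ≼ b ⊎ b ≼ a
≼-total []      []      = inj₁ (inj₂ refl)
≼-total (m ∷ a) (n ∷ b) with ℕₚ.<-cmp m n
... | tri< lt _ _   = inj₁ (inj₁ (hd lt))
... | tri> _ _ gt   = inj₂ (inj₁ (hd gt))
... | tri≈ _ refl _ = Sum.map (Sum.map tl (cong (m ∷_))) (Sum.map tl (cong (m ∷_))) (≼-total a b)

≼-trans : ∀ {k} {a b c : Vec ℕ k} → a ≼ b → b ≼ c → a ≼ c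
≼-trans (inj₁ p)    q = inj₁ (≺-≼-trans p q)
≼-trans (inj₂ refl) q = q

-- From thin covers to condensation steps

module Splitting (s : ℕ) (M : TreeAutomaton (Maybe (Fin s) × Maybe (Fin s))) where

  open Engine s
  open Types s M
  open Covers s M
  open Fixpoint s M using (reg-≤)

  Same : List RSet → Tr → Tr → Set
  Same Rs z u = All (λ R → (z ∈ᵣ R → u ∈ᵣ R) × (u ∈ᵣ R → z ∈ᵣ R)) Rs

  compl : RSet → RSet
  compl R = rel (reg-¬ (reg-∈ R))

  -- X is cut by each R in turn. All cells remain recognizable, so emptiness is decidable and a
  -- nonempty cell yields a representative.
  reps : ∀ Rs X → ∃ λ us → ∀ z → z ∈ᵣ X → Any (λ u → u ∈ᵣ X × Same Rs z u) us
  reps [] X with decide (reg-∃ (reg-∈ X)) []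
  ... | yes (u , u∈) = u ∷ [] , λ z _ → here (u∈ , [])
  ... | no none      = [] , λ z z∈ → contradiction (z , z∈) none
  reps (R ∷ Rs) X = proj₁ ins ++ proj₁ outs , λ z z∈ → by z z∈ (decide (reg-∈ R) (z ∷ []))
    where
    ins  = reps Rs (X ∩ R)
    outs = reps Rs (X ∩ compl R)
    by : ∀ z → z ∈ᵣ X → Dec (z ∈ᵣ R) → Any (λ u → u ∈ᵣ X × Same (R ∷ Rs) z u) (proj₁ ins ++ proj₁ outs)
    by z z∈ (yes zR) = ++⁺ˡ (Any.map (λ {u} (u∈ , same) → let (uX , uR) = ∈∩⇒ X R u∈ in
      uX , ((λ _ → uR) , (λ _ → zR)) ∷ same) (proj₂ ins z (∈∩⇐ X R z∈ zR)))
    by z z∈ (no ¬zR) = ++⁺ʳ (proj₁ ins) (Any.map (λ {u} (u∈ , same) → let (uX , u¬R) = ∈∩⇒ X (compl R) u∈ in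
      uX , ((λ h → contradiction h ¬zR) , (λ h → contradiction h (∈⇒ (reg-¬ (reg-∈ R)) u¬R))) ∷ same)
      (proj₂ outs z (∈∩⇐ X (compl R) z∈ (∈⇐ (reg-¬ (reg-∈ R)) ¬zR))))

  max-rank : ∀ {k P} {c : Vec ℕ k} (p : Piece P c) ps → ∃ λ m → m ≺ c × All (λ q → rank q ≼ m) (p ∷ ps)
  max-rank p [] = rank p , below p , inj₂ refl ∷ []
  max-rank p (q ∷ ps) with max-rank q ps
  ... | m , m≺ , qs with ≼-total (rank p) m
  ...   | inj₁ p≼m = m , m≺ , p≼m ∷ qs
  ...   | inj₂ ge = rank p , below p , inj₂ refl ∷ All.map (λ r → ≼-trans r ge) qs

  module _ {k : ℕ} {D : H → Bool} {P : Pr} (lin : Lin (_∈H D) P) (D⊆ : ∀ {u v} → u ≤[ P ] v → u ∈H D × v ∈H D) where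

    open Lin lin

    reg-dom : RegSet (_∈H D)
    reg-dom = reg-iff (λ { (t ∷ []) → inH }) (λ { (t ∷ []) → type }) (reg-alg {P = T ∘ D} finH ηA (λ _ → T? _))

    reg-btw : ∀ x y → RegSet (Btw P x y)
    reg-btw x y = reg-iff (λ { (_ ∷ []) → id }) (λ { (_ ∷ []) → id })
      (reg-sec y (reg-sec x (reg-⊎ (reg-× (reg-re (i0 ∷ i2 ∷ []) (reg-≤ P)) (reg-re (i2 ∷ i1 ∷ []) (reg-≤ P)))
                                   (reg-× (reg-re (i1 ∷ i2 ∷ []) (reg-≤ P)) (reg-re (i2 ∷ i0 ∷ []) (reg-≤ P))))))

    Above Below : RSet → Tr → Set
    Above X z = ∃ λ t → t ∈ᵣ X × t ≤[ P ] z
    Below X z = ∃ λ t → t ∈ᵣ X × z ≤[ P ] t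

    reg-above : ∀ X → RegSet (Above X)
    reg-above X = reg-iff (λ { (_ ∷ []) → id }) (λ { (_ ∷ []) → id })
      (reg-∃ (reg-× (reg-re (i0 ∷ []) (reg-∈ X)) (reg-re (i0 ∷ i1 ∷ []) (reg-≤ P))))

    reg-below : ∀ X → RegSet (Below X)
    reg-below X = reg-iff (λ { (_ ∷ []) → id }) (λ { (_ ∷ []) → id })
      (reg-∃ (reg-× (reg-re (i0 ∷ []) (reg-∈ X)) (reg-re (i1 ∷ i0 ∷ []) (reg-≤ P))))

    Interval : Vec ℕ k → Tr → Tr → Set
    Interval c x y = Cover P c (λ z → z ∈H D × Btw P x y z)

    _▹_ : ∀ {x y z} → x ≤[ P ] y → y ≤[ P ] z → x ≤[ P ] z
    p ▹ q = ≤-trans (proj₁ (D⊆ p)) (proj₁ (D⊆ q)) (proj₂ (D⊆ q)) p q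

    hull : ∀ {x y z r w} → Btw P x y z → Btw P x y r → z ≤[ P ] w → w ≤[ P ] r → Btw P x y w
    hull (inj₁ (x≤z , _)) (inj₁ (_ , r≤y)) p q = inj₁ (x≤z ▹ p , q ▹ r≤y)
    hull (inj₁ (x≤z , z≤y)) (inj₂ (_ , r≤x)) p q = inj₁ (x≤z ▹ p , (q ▹ r≤x) ▹ (x≤z ▹ z≤y))
    hull (inj₂ (y≤z , z≤x)) (inj₁ (_ , r≤y)) p q = inj₂ (y≤z ▹ p , (q ▹ r≤y) ▹ (y≤z ▹ z≤x))
    hull (inj₂ (y≤z , _)) (inj₂ (_ , r≤x)) p q = inj₂ (y≤z ▹ p , q ▹ r≤x)

    between-≤ : ∀ {x y z} → x ∈H D → x ≤[ P ] y → Btw P x y z → x ≤[ P ] z × z ≤[ P ] y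
    between-≤ x∈ x≤y (inj₁ p) = p
    between-≤ x∈ x≤y (inj₂ (y≤z , z≤x)) =
      let z∈ = proj₁ (D⊆ z≤x) ; y∈ = proj₁ (D⊆ y≤z) in ≤-trans x∈ y∈ z∈ x≤y y≤z , ≤-trans z∈ x∈ y∈ z≤x x≤y

    module _ {c : Vec ℕ k} {z r : Tr} (z∈ : z ∈H D) (r∈ : r ∈H D) (z≢r : z ≢ r) where

      -- Both z and r lie in the convex hull of the piece, so what it contributes between them lies
      -- between two of its own members, where thinness gives pieces of rank below its own. A
      -- one-point piece would force z and r to coincide.
      refine : ∀ {m} {p : Piece P c} → rank p ≼ m → (Above (set p) z × Below (set p) z) → (Above (set p) r × Below (set p) r) →
               Cover P m (λ w → w ∈ᵣ set p × Btw P z r w)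
      refine {m} {p} p≼m ((t , t∈ , t≤z) , (t′ , t′∈ , z≤t′)) ((u , u∈ , u≤r) , (u′ , u′∈ , r≤u′)) with thin p
      ... | point same = contradiction (trans (squeeze t≤z z≤t′ t∈ t′∈) (trans (same t∈ u∈) (sym (squeeze u≤r r≤u′ u∈ u′∈)))) z≢r
        where
        squeeze : ∀ {t t′ z} → t ≤[ P ] z → z ≤[ P ] t′ → t ∈ᵣ set p → t′ ∈ᵣ set p → z ≡ t
        squeeze {t} {t′} {z} q q′ t∈ t′∈ = ≤-antisym (proj₂ (D⊆ q)) (proj₁ (D⊆ q)) (subst (z ≤[ P ]_) (same t′∈ t∈) q′) q
      ... | covered f = case ≤-total z∈ r∈ of λ where
              (inj₁ z≤r) → cover-⊆ (λ w (w∈ , b) → let (z≤w , w≤r) = between-≤ z∈ z≤r b ; wD = proj₁ (D⊆ w≤r) in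
                             w∈ , ≤-trans (proj₁ (D⊆ t≤z)) z∈ wD t≤z z≤w , ≤-trans wD r∈ (proj₂ (D⊆ r≤u′)) w≤r r≤u′) (within t∈ u′∈)
              (inj₂ r≤z) → cover-⊆ (λ w (w∈ , b) → let (r≤w , w≤z) = between-≤ r∈ r≤z (swap b) ; wD = proj₁ (D⊆ w≤z) in
                             w∈ , ≤-trans (proj₁ (D⊆ u≤r)) r∈ wD u≤r r≤w , ≤-trans wD z∈ (proj₂ (D⊆ z≤t′)) w≤z z≤t′) (within u∈ t′∈)
        where
        within : ∀ {t t′} → t ∈ᵣ set p → t′ ∈ᵣ set p → Cover P m (λ w → w ∈ᵣ set p × t ≤[ P ] w × w ≤[ P ] t′)
        within t∈ t′∈ = let (qs , h) = f t∈ t′∈ in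
          List.map (λ q → piece (≺-≼-trans (below q) p≼m) (set q) (thin q)) qs , λ w (w∈ , p , q) → map⁺ (h w w∈ p q)

      -- If no member of the piece is below z, the same holds for r, and then the piece misses the
      -- interval between them; dually for members above. Otherwise both are in its hull.
      part : ∀ {m} (p : Piece P c) → rank p ≼ m →
             (Above (set p) z → Above (set p) r) → (Above (set p) r → Above (set p) z) →
             (Below (set p) z → Below (set p) r) → (Below (set p) r → Below (set p) z) →
             Cover P m (λ w → w ∈ᵣ set p × Btw P z r w)
      part p p≼m a a′ b b′ with decide (reg-above (set p)) (z ∷ []) | decide (reg-below (set p)) (z ∷ [])
      ... | yes az | yes bz = refine {p = p} p≼m (az , bz) (a az , b bz)
      ... | no ¬az | _ = cover-∅ λ { w (w∈ , inj₁ (_ , w≤r)) → ¬az (a′ (w , w∈ , w≤r)) ; w (w∈ , inj₂ (_ , w≤z)) → ¬az (w , w∈ , w≤z) }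
      ... | yes _ | no ¬bz = cover-∅ λ { w (w∈ , inj₁ (z≤w , _)) → ¬bz (w , w∈ , z≤w) ; w (w∈ , inj₂ (r≤w , _)) → ¬bz (b′ (w , w∈ , r≤w)) }

    -- Pieces are not convex, so `us` represents not the pieces but the cells cut out by their
    -- up-sets and down-sets. For z and r in one cell every piece can be refined, and the largest
    -- rank m of a piece, which is below c, bounds the new cover.
    split : ∀ {c x y} → x ∈H D → y ∈H D → Interval c x y → ∃ λ us → ∀ z → z ∈H D → Btw P x y z →
            Any (λ r → r ∈H D × (z ≡ r ⊎ ∃ λ c′ → c′ ≺ c × Interval c′ z r)) us
    split {c} {x} {y} x∈ y∈ ([] , h) = [] , λ z z∈ b → contradiction (h z (z∈ , b)) λ ()
    split {c} {x} {y} x∈ y∈ (p₀ ∷ ps₀ , h) = proj₁ rs , λ z z∈ b →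
      Any.map (λ {r} (r∈ , same) → by z r z∈ b (∈⇒ reg-I r∈) same) (proj₂ rs z (∈⇐ reg-I (z∈ , b)))
      where
      ps = p₀ ∷ ps₀
      aboves = List.map (λ p → rel (reg-above (set p))) ps
      belows = List.map (λ p → rel (reg-below (set p))) ps
      reg-I : RegSet (λ z → z ∈H D × Btw P x y z)
      reg-I = reg-× reg-dom (reg-btw x y)
      rs = reps (aboves ++ belows) (rel reg-I)
      m : Vec ℕ k
      m = proj₁ (max-rank p₀ ps₀)
      by : ∀ z r → z ∈H D → Btw P x y z → r ∈H D × Btw P x y r → Same (aboves ++ belows) z r →
           r ∈H D × (z ≡ r ⊎ ∃ λ c′ → c′ ≺ c × Interval c′ z r)
      by z r z∈ b (r∈ , b′) same = r∈ , (case decide (reg-single r) (z ∷ []) of λ where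
          (yes e) → inj₁ e
          (no ne) → inj₂ (m , proj₁ (proj₂ (max-rank p₀ ps₀)) , finer ne))
        where
        finer : z ≢ r → Interval m z r
        finer ne = cover-⊆ (λ w (w∈ , bw) → Any.map (λ {p} q → q , bw) (h w (w∈ , inside w w∈ bw)))
          (cover-∈ ps λ {p} p∈ → part z∈ r∈ ne p (All.lookup (proj₂ (proj₂ (max-rank p₀ ps₀))) p∈)
            (proj₁ (above p∈)) (proj₂ (above p∈)) (proj₁ (blw p∈)) (proj₂ (blw p∈)))
          where
          inside : ∀ w → w ∈H D → Btw P z r w → Btw P x y w
          inside w w∈ (inj₁ (p , q)) = hull b b′ p q
          inside w w∈ (inj₂ (p , q)) = hull b′ b p q
          above : ∀ {p} → p ∈ ps → (Above (set p) z → Above (set p) r) × (Above (set p) r → Above (set p) z)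
          above {p} p∈ = let (f , g) = All.lookup same (∈-++⁺ˡ (∈-map⁺ (λ p → rel (reg-above (set p))) p∈)) in
            (λ a → ∈⇒ (reg-above (set p)) (f (∈⇐ (reg-above (set p)) a))) , (λ a → ∈⇒ (reg-above (set p)) (g (∈⇐ (reg-above (set p)) a)))
          blw : ∀ {p} → p ∈ ps → (Below (set p) z → Below (set p) r) × (Below (set p) r → Below (set p) z)
          blw {p} p∈ = let (f , g) = All.lookup same (∈-++⁺ʳ aboves (∈-map⁺ (λ p → rel (reg-below (set p))) p∈)) in
            (λ a → ∈⇒ (reg-below (set p)) (f (∈⇐ (reg-below (set p)) a))) , (λ a → ∈⇒ (reg-below (set p)) (g (∈⇐ (reg-below (set p)) a)))

-- Iterated condensation along Cantor normal forms

module Ranks {A : Set} {_≤_ : A → A → Set} (order : IsTotalOrder _≡_ _≤_) where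

  open Condensation _≤_
  open IsTotalOrder order renaming (trans to ≤-trans; antisym to ≤-antisym)

  Convex : Rel → Set
  Convex R = ∀ {x y z} → R x y → Between x y z → R z y

  between-shrink : ∀ {x y z w} → Between x y z → Between z y w → Between x y w
  between-shrink (inj₁ (p , q)) (inj₁ (r , t)) = inj₁ (≤-trans p r , t)
  between-shrink (inj₁ (p , q)) (inj₂ (r , t)) = inj₁ (≤-trans p (≤-trans q r) , ≤-trans t q)
  between-shrink (inj₂ (p , q)) (inj₁ (r , t)) = inj₂ (≤-trans p r , ≤-trans t (≤-trans p q))
  between-shrink (inj₂ (p , q)) (inj₂ (r , t)) = inj₂ (r , ≤-trans t q)

  convex-≡ : Convex _≡_
  convex-≡ refl (inj₁ (p , q)) = ≤-antisym q p
  convex-≡ refl (inj₂ (p , q)) = ≤-antisym q p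

  convex-step : ∀ {R} → Convex (step R)
  convex-step (zs , h) b = zs , λ w c → h w (between-shrink b c)

  convex-addω : ∀ i {R} → Convex R → Convex (addω i R)
  convex-iter : ∀ i m {R} → Convex R → Convex (iterRel (addω i) m R)
  convex-addω zero    {R} c = convex-step {R}
  convex-addω (suc i) c (m , r) b = m , convex-iter i m c r b
  convex-iter i zero    c = c
  convex-iter i (suc m) c = convex-addω i (convex-iter i m c)

  -- An arbitrary R need not be contained in `step R`. Convexity puts the whole interval into the
  -- class of y, so y alone covers it.
  extend : ∀ i {R} → Convex R → ∀ {x y} → R x y → addω i R x y
  extend zero    c {y = y} r = y ∷ [] , λ z b → here (c r b)
  extend (suc i) c r = 0 , r

  step-mono : ∀ {R S : Rel} → (∀ {x y} → R x y → S x y) → ∀ {x y} → step R x y → step S x y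
  step-mono f (zs , h) = zs , λ z b → Any.map f (h z b)

  extend-iter : ∀ i {R} → Convex R → ∀ {m n} → m ℕ.≤ n → ∀ {x y} → iterRel (addω i) m R x y → iterRel (addω i) n R x y
  extend-iter i {R} c {m} {n} le {x} {y} r with ℕₚ.m≤n⇒∃[o]m+o≡n le
  ... | d , refl = go d
    where
    go : ∀ d → iterRel (addω i) (m + d) R x y
    go zero    = subst (λ n → iterRel (addω i) n R x y) (sym (ℕₚ.+-identityʳ m)) r
    go (suc d) = subst (λ n → iterRel (addω i) n R x y) (sym (ℕₚ.+-suc m d)) (extend i (convex-iter i (m + d) c) (go d))

  -- Translates descent along `≺` into ω^k condensation steps, by induction on the number of
  -- coefficients. With leading coefficient n, the tails cost one block of ω^k steps on top of n
  -- blocks; a smaller leading coefficient m was settled after m + 1 ≤ n blocks. Hence the witness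
  -- `suc n`.
  ranked : ∀ k (D : Vec ℕ k → Rel) R → Convex R →
           (∀ c {x y} → D c x y → step (λ z r → R z r ⊎ ∃ λ c′ → c′ ≺ c × D c′ z r) x y) →
           ∀ c {x y} → D c x y → addω k R x y
  ranked zero    D R cR h [] d = step-mono (λ { (inj₁ r) → r ; (inj₂ (_ , () , _)) }) (h [] d)
  ranked (suc k) D R cR h (n ∷ c) d = suc n , go n (<-wellFounded n) c d
    where
    go : ∀ n → Acc _<_ n → ∀ c {x y} → D (n ∷ c) x y → iterRel (addω k) (suc n) R x y
    go n (acc rs) = ranked k (λ c → D (n ∷ c)) (iterRel (addω k) n R) (convex-iter k n cR) λ c d → step-mono (λ where
      (inj₁ r)                     → inj₁ (extend-iter k {R} cR {0} {n} z≤n r)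
      (inj₂ (_ , hd {m = m} {a = a} lt , d)) → inj₁ (extend-iter k {R} cR {suc m} {n} lt (go m (rs lt) a d))
      (inj₂ (_ , tl lt , d))       → inj₂ (_ , lt , d)) (h (n ∷ c) d)

  convex-cond : ∀ ds {R : Rel} → Convex R → ∀ {x y} → R x y → List.foldl (λ R e → addω e R) R ds x y
  convex-cond []       c r = r
  convex-cond (d ∷ ds) c r = convex-cond ds (convex-addω d c) (extend d c r)

  module _ (E : Rel) (E-step : ∀ {x y} → step E x y → E x y) where

    addω-⊆ : ∀ i {R : Rel} → (∀ {x y} → R x y → E x y) → ∀ {x y} → addω i R x y → E x y
    iter-⊆ : ∀ i m {R : Rel} → (∀ {x y} → R x y → E x y) → ∀ {x y} → iterRel (addω i) m R x y → E x y
    addω-⊆ zero    f s       = E-step (step-mono f s)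
    addω-⊆ (suc i) f (m , r) = iter-⊆ i m f r
    iter-⊆ i zero    f = f
    iter-⊆ i (suc m) f = addω-⊆ i (iter-⊆ i m f)

    foldl-⊆ : ∀ es {R : Rel} → (∀ {x y} → R x y → E x y) → ∀ {x y} → List.foldl (λ R e → addω e R) R es x y → E x y
    foldl-⊆ []       f = f
    foldl-⊆ (e ∷ es) f = foldl-⊆ es (addω-⊆ e f)

-- From the presentation to an order on trees

fst-tree snd-tree : ∀ {S : Set} → Tree (Maybe S × Maybe S) → Tree S
fst-tree leaf                     = leaf
fst-tree (node (just a , _) l r)  = node a (fst-tree l) (fst-tree r)
fst-tree (node (nothing , _) l r) = leaf
snd-tree leaf                     = leaf
snd-tree (node (_ , just b) l r)  = node b (snd-tree l) (snd-tree r)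
snd-tree (node (_ , nothing) l r) = leaf

fst-conv : ∀ {S : Set} (u v : Tree S) → fst-tree (conv u v) ≡ u
fst-conv leaf         leaf           = refl
fst-conv leaf         (node b l r)   = refl
fst-conv (node a l r) leaf           = cong₂ (node a) (fst-conv l leaf) (fst-conv r leaf)
fst-conv (node a l r) (node b l′ r′) = cong₂ (node a) (fst-conv l l′) (fst-conv r r′)

snd-conv : ∀ {S : Set} (u v : Tree S) → snd-tree (conv u v) ≡ v
snd-conv leaf         leaf           = refl
snd-conv (node a l r) leaf           = refl
snd-conv leaf         (node b l r)   = cong₂ (node b) (snd-conv leaf l) (snd-conv leaf r)
snd-conv (node a l r) (node b l′ r′) = cong₂ (node b) (snd-conv l l′) (snd-conv r r′)

conv-injective : ∀ {S : Set} {u v u′ v′ : Tree S} → conv u v ≡ conv u′ v′ → u ≡ u′ × v ≡ v′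
conv-injective e = trans (sym (fst-conv _ _)) (trans (cong fst-tree e) (fst-conv _ _)) ,
                   trans (sym (snd-conv _ _)) (trans (cong snd-tree e) (snd-conv _ _))

module Presented {A : Set} {_≤_ : A → A → Set} (order : IsTotalOrder _≡_ _≤_)
                 (pres : TreeAutomaticPresentation A _≤_) where

  open TreeAutomaticPresentation pres
  open Engine s
  open Types s leqA
  open Covers s leqA
  open Soundness s leqA
  open Fixpoint s leqA
  open Splitting s leqA
  open Condensation _≤_ hiding (Rel)
  open Ranks order using (convex-≡; ranked)
  open IsTotalOrder order using (total) renaming (refl to ≤-refl; trans to ≤-trans; antisym to ≤-antisym)

  P₀ : Pr
  P₀ = tabulate (TreeAutomaton.F leqA)

  -- By reflexivity and `leqSpec` a tree names an element exactly when it is related to itself. So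
  -- the domain is read off the diagonal value and is a union of classes of `η`.
  D₀ : H → Bool
  D₀ = TreeAutomaton.F leqA ∘ dg

  tree-injective : ∀ {x y} → tree x ≡ tree y → x ≡ y
  tree-injective {x} {y} e = Bijection.injective μ (Σ-≡ (Bijection.to μ x) (Bijection.to μ y) e)
    where
    Σ-≡ : (p q : Σ (Tree (Fin s)) (TreeAutomaton.Accepts domA)) → proj₁ p ≡ proj₁ q → p ≡ q
    Σ-≡ (t , p) (.t , q) refl = cong (t ,_) (T-irrelevant p q)

  ≤⇒ : ∀ {u v} → u ≤[ P₀ ] v → ∃₂ λ x y → x ≤ y × tree x ≡ u × tree y ≡ v
  ≤⇒ {u} {v} (le h) = let
      (x , y , x≤y , e) = Equivalence.to (leqSpec (conv u v)) (subst T (lookup∘tabulate (TreeAutomaton.F leqA) (τ u v)) h)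
      (e₁ , e₂) = conv-injective e
    in x , y , x≤y , sym e₁ , sym e₂

  ≤⇐ : ∀ {x y} → x ≤ y → tree x ≤[ P₀ ] tree y
  ≤⇐ {x} {y} p = le (subst T (sym (lookup∘tabulate (TreeAutomaton.F leqA) (τ (tree x) (tree y))))
    (Equivalence.from (leqSpec (conv (tree x) (tree y))) (x , y , p , refl)))

  ≤⇒′ : ∀ {x y} → tree x ≤[ P₀ ] tree y → x ≤ y
  ≤⇒′ p = let (x , y , x≤y , e₁ , e₂) = ≤⇒ p in
    subst (_ ≤_) (tree-injective e₂) (subst (_≤ y) (tree-injective e₁) x≤y)

  self⇒dom : ∀ {u} → u ≤[ P₀ ] u → u ∈H D₀
  self⇒dom {u} (le h) = inH (subst T (lookup∘tabulate (TreeAutomaton.F leqA) (τ u u)) h)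

  tree∈ : ∀ x → tree x ∈H D₀
  tree∈ x = self⇒dom (≤⇐ ≤-refl)

  element : ∀ {u} → u ∈H D₀ → ∃ λ x → tree x ≡ u
  element {u} (inH h) = let (x , _ , _ , e , _) = ≤⇒ {u} {u} (le (subst T (sym (lookup∘tabulate (TreeAutomaton.F leqA) (τ u u))) h)) in x , e

  ≤-dom : ∀ {u v} → u ≤[ P₀ ] v → u ∈H D₀ × v ∈H D₀
  ≤-dom p = let (x , y , _ , e₁ , e₂) = ≤⇒ p in subst (_∈H D₀) e₁ (tree∈ x) , subst (_∈H D₀) e₂ (tree∈ y)

  Named : Tr → Set
  Named u = ∃ λ x → tree x ≡ u

  lin₀ : Lin (_∈H D₀) P₀
  lin₀ = record
    { ≤-refl    = λ u∈ → refl′ (element u∈)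
    ; ≤-antisym = λ u∈ v∈ → antisym′ (element u∈) (element v∈)
    ; ≤-trans   = λ u∈ v∈ w∈ → trans′ (element u∈) (element v∈) (element w∈)
    ; ≤-total   = λ u∈ v∈ → total′ (element u∈) (element v∈) }
    where
    refl′ : ∀ {u} → Named u → u ≤[ P₀ ] u
    refl′ (x , refl) = ≤⇐ ≤-refl
    antisym′ : ∀ {u v} → Named u → Named v → u ≤[ P₀ ] v → v ≤[ P₀ ] u → u ≡ v
    antisym′ (x , refl) (y , refl) p q = cong tree (≤-antisym (≤⇒′ p) (≤⇒′ q))
    trans′ : ∀ {u v w} → Named u → Named v → Named w → u ≤[ P₀ ] v → v ≤[ P₀ ] w → u ≤[ P₀ ] w
    trans′ (x , refl) (y , refl) (z , refl) p q = ≤⇐ (≤-trans (≤⇒′ p) (≤⇒′ q))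
    total′ : ∀ {u v} → Named u → Named v → u ≤[ P₀ ] v ⊎ v ≤[ P₀ ] u
    total′ (x , refl) (y , refl) = Sum.map ≤⇐ ≤⇐ (total x y)

  btw⇒ : ∀ {x y z} → Btw P₀ (tree x) (tree y) (tree z) → Between x y z
  btw⇒ = Sum.map (λ (p , q) → ≤⇒′ p , ≤⇒′ q) (λ (p , q) → ≤⇒′ p , ≤⇒′ q)

  btw⇐ : ∀ {x y z} → Between x y z → Btw P₀ (tree x) (tree y) (tree z)
  btw⇐ = Sum.map (λ (p , q) → ≤⇐ p , ≤⇐ q) (λ (p , q) → ≤⇐ p , ≤⇐ q)

  level : ℕ
  level = proj₁ stable

  S∞ : Subset N
  S∞ = proj₁ (proj₂ stable)

  open Rules ⟦ S∞ ⟧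
  open Good ⟦ S∞ ⟧
  open AtFixpoint S∞ (proj₂ (proj₂ (proj₂ stable)))

  EA : A → A → Set
  EA x y = E D₀ P₀ (tree x) (tree y)

  EA-refl : ∀ {x y} → x ≡ y → EA x y
  EA-refl refl = Sat.E-refl saturated lin₀ (tree∈ _)

  EA-step : ∀ {x y} → step EA x y → EA x y
  EA-step {x} {y} (zs , h) = E-step saturated canonical lin₀ (tree∈ x) (tree∈ y) (List.map tree zs) cover
    where
    cover : ∀ z → z ∈H D₀ → Btw P₀ (tree x) (tree y) z → Any (λ r → r ∈H D₀ × E D₀ P₀ z r) (List.map tree zs)
    cover z z∈ b = case element z∈ of λ { (a , refl) → map⁺ (Any.map (λ {r} e → tree∈ r , e) (h a (btw⇒ b))) }

  -- `SoundAt level` speaks of ranks below ω^(level+1), written with level + 2 coefficients;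
  -- `ranked` turns the number of coefficients into the exponent.
  k : ℕ
  k = suc (suc level)

  Ranked : Vec ℕ k → A → A → Set
  Ranked c x y = Interval lin₀ ≤-dom c (tree x) (tree y)

  here-element : ∀ u → Dec (u ∈H D₀) → List A
  here-element u (yes u∈) = proj₁ (element u∈) ∷ []
  here-element u (no _)   = []

  elements : List Tr → List A
  elements = List.concatMap λ u → here-element u (map′ inH type (T? _))

  Any-elements : ∀ {Q : A → Set} {Q′ : Tr → Set} us → (∀ x → Q′ (tree x) → Q x) →
                 Any (λ u → u ∈H D₀ × Q′ u) us → Any Q (elements us)
  Any-elements {Q} {Q′} us f p = concatMap⁺ (λ u → here-element u (map′ inH type (T? _)))
    (Any.map (λ {u} (u∈ , q) → one u u∈ q (map′ inH type (T? _))) p)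
    where
    one : ∀ u → u ∈H D₀ → Q′ u → (d : Dec (u ∈H D₀)) → Any Q (here-element u d)
    one u u∈ q (yes u∈′) = here (f _ (subst Q′ (sym (proj₂ (element u∈′))) q))
    one u u∈ q (no ¬u∈)  = contradiction u∈ ¬u∈

  Ranked-step : ∀ c {x y} → Ranked c x y → step (λ z r → z ≡ r ⊎ ∃ λ c′ → c′ ≺ c × Ranked c′ z r) x y
  Ranked-step c {x} {y} d = elements (proj₁ sp) , λ z b → Any-elements (proj₁ sp)
    (λ r → Sum.map₁ tree-injective) (proj₂ sp (tree z) (tree∈ z) (btw⇐ b))
    where
    sp = split lin₀ ≤-dom (tree∈ x) (tree∈ y) d

  EA⇒cond : ∀ {x y} → EA x y → cond (k ∷ []) x y
  EA⇒cond e = ranked k Ranked _≡_ convex-≡ Ranked-step (ω (suc level))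
    (Use.cover-E ⟦ S∞ ⟧ (proj₁ (proj₂ (proj₂ stable))) e lin₀)

-- FC-rank below ω^ω is expressed as stability from a coded ordinal on. Already the instance
-- `0 ∷ []` for ds says that one more step changes nothing, so the relations at and beyond ω^ω
-- coincide with it as well.
theorem22 : (A : Set) (_≤_ : A → A → Set) → IsTotalOrder _≡_ _≤_ →
    TreeAutomaticPresentation A _≤_ →
    ∃ λ (es : List ℕ) → ∀ (ds : List ℕ) (x y : A) →
    Condensation.cond _≤_ (es ++ ds) x y ⇔ Condensation.cond _≤_ es x y
theorem22 A _≤_ order pres = k ∷ [] , λ ds x y → mk⇔
    (λ c → EA⇒cond (foldl-⊆ EA EA-step (k ∷ ds) EA-refl c))
    (convex-cond ds (convex-addω k convex-≡))
  where
  open Ranks order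
  open Presented order pres
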